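{- For every $n\ge 0$, the number of hesitating tableaux of length $2n$ whose diagrams all have at most two rows and whose last diagram is a one-row shape $(m)$ for some $m\ge 0$ equals the Baxter number $B_{n+1}$, where \[B_N=\sum_{k=1}^N\frac{\binom{N+1}{k-1}\binom{N+1}{k}\binom{N+1}{k+1}}{\binom{N+1}{1}\binom{N+1}{2}}\] (equivalently, $B_N$ is the number of Baxter permutations of size $N$).
   Context: Partitions are identified with their Ferrers diagrams, and $\lambda\le\mu$ means $\lambda_i\le\mu_i$ for all $i$. A hesitating tableau of length $2n$ is a sequence $(\lambda^{(0)},\dots,\lambda^{(2n)})$ of Ferrers diagrams with $\lambda^{(0)}=\varnothing$ such that for each $i$, the pair of steps from $\lambda^{(2i)}$ to $\lambda^{(2i+2)}$ is one of: (a) $\lambda^{(2i+1)}=\lambda^{(2i)}$ and $\lambda^{(2i+2)}$ is obtained from $\lambda^{(2i+1)}$ by adding one box; (b) $\lambda^{(2i+1)}$ is obtained from $\lambda^{(2i)}$ by removing one box and $\lambda^{(2i+2)}=\lambda^{(2i+1)}$; (c) $\lambda^{(2i+1)}$ is obtained from $\lambda^{(2i)}$ by adding one box and $\lambda^{(2i+2)}$ is obtained from $\lambda^{(2i+1)}$ by removing one box. The shape $(0)$ is the empty shape. A Baxter permutation of size $N$ is a permutation $\sigma$ of $\{1,\dots,N\}$ with no indices $i<j<k$ such that $\sigma(j+1)<\sigma(i)<\sigma(k)<\sigma(j)$ or $\sigma(j)<\sigma(k)<\sigma(i)<\sigma(j+1)$. -}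

module Defs where

open import Data.Nat using (ℕ; zero; suc; _+_; _*_; _≤_; _<_; _/_; NonZero; >-nonZero; z<s)
open import Data.Nat.Properties using (m*n≢0; ≤-<-trans; m≤m+n; ≤-refl)
open import Data.Nat.Combinatorics using (_C_; nC1≡n; nCk+nC[k+1]≡[n+1]C[k+1])
open import Data.List using (List; []; _∷_; _∷ʳ_; length; map; upTo)
open import Data.Nat.ListAction using (sum)
open import Data.List.Relation.Unary.All using (All)
open import Data.List.Relation.Unary.Unique.Propositional using (Unique)
open import Data.List.Membership.Propositional using (_∈_)
open import Data.Product using (_×_; _,_; ∃; ∃-syntax)
open import Data.Sum using (_⊎_)
open import Data.Unit using (⊤)
open import Data.Empty using (⊥)
open import Function.Bundles using (_⇔_)
open import Relation.Binary.PropositionalEquality using (_≡_; refl; subst; sym)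

-- Ferrers diagrams with at most two rows.
-- A pair (a , b) stands for the diagram with row lengths a ≥ b
-- (rows of length 0 omitted); e.g. (0 , 0) is the empty shape and
-- (m , 0) is the one-row shape (m).

Shape : Set
Shape = ℕ × ℕ

IsDiagram : Shape → Set
IsDiagram (a , b) = b ≤ a

AddBox : Shape → Shape → Set
AddBox (a , b) (a′ , b′) = (a′ ≡ suc a × b′ ≡ b) ⊎ (a′ ≡ a × b′ ≡ suc b)

RemoveBox : Shape → Shape → Set
RemoveBox μ ν = AddBox ν μ

-- One double step λ^(2i) → λ^(2i+1) → λ^(2i+2), cases (a), (b), (c).
HStep : Shape → Shape → Shape → Set
HStep p q r =
    (q ≡ p × AddBox q r)
  ⊎ (RemoveBox p q × r ≡ q)
  ⊎ (AddBox p q × RemoveBox q r)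

HesFrom : Shape → List Shape → Set
HesFrom p []            = ⊤
HesFrom p (q ∷ [])      = ⊥
HesFrom p (q ∷ r ∷ xs)  = HStep p q r × HesFrom r xs

IsTwoRowHTOneRowEnd : ℕ → List Shape → Set
IsTwoRowHTOneRowEnd n []       = ⊥
IsTwoRowHTOneRowEnd n (p ∷ xs) =
    length (p ∷ xs) ≡ suc (2 * n)
  × p ≡ (0 , 0)
  × HesFrom p xs
  × All IsDiagram (p ∷ xs)
  × ∃[ m ] ∃[ ys ] (p ∷ xs) ≡ ys ∷ʳ (m , 0)

HasCount : {A : Set} → (A → Set) → ℕ → Set
HasCount {A} P N =
  ∃[ xs ] (length xs ≡ N × Unique xs × (∀ x → (x ∈ xs) ⇔ P x))

-- (N+2) C 2 > 0, used only to license the (exact) division below.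
C2-pos : ∀ N → 0 < suc (suc N) C 2
C2-pos N = subst (0 <_) (nCk+nC[k+1]≡[n+1]C[k+1] (suc N) 1)
             (subst (λ x → 0 < x + (suc N C 2)) (sym (nC1≡n (suc N))) z<s)

Baxter : ℕ → ℕ
Baxter zero    = 0   -- empty sum
Baxter (suc N) =
  sum (map (λ j → term (suc j)) (upTo (suc N)))
  where
    M : ℕ
    M = suc (suc N)   -- = N' + 1 where N' = suc N
    instance
      nz₂ : NonZero (M C 2)
      nz₂ = >-nonZero (C2-pos N)
      nzM : NonZero ((M C 1) * (M C 2))
      nzM = m*n≢0 (M C 1) (M C 2) {{subst NonZero (sym (nC1≡n M)) _}} {{nz₂}}
    term : ℕ → ℕ
    term zero    = 0
    term (suc k′) = ((M C k′) * (M C (suc k′)) * (M C (suc (suc k′)))) / ((M C 1) * (M C 2))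

{-# OPTIONS --safe #-}
-- In coordinates x + y + z = 0 a double step of a two-row hesitating tableau is one of the six
-- roots e_i − e_j or one of two loops, and the walls of the region of diagrams are (after a shift)
-- those of a Weyl chamber of G₂ = S₃ × {±1}; the loop forbidden at a = b is exactly what the
-- reflection principle removes. So the number of tableaux from the empty shape to a one-row shape
-- is a signed sum, over the twelve elements of G₂, of numbers of unrestricted walks from (2 , 1 ,
-- −3) to the images of the ray of one-row shapes. These rays lie in oppositely signed pairs on six
-- lines, the sum telescopes, and by the G₂-symmetry of unrestricted walks only six terms survive.
-- An unrestricted walk is a triple of walkers making steps 0 or 1, and the six terms are the six
-- terms of the determinants det (C(n , k + i − j)) of size 3 summed over k, each of which equals
-- C(n+2 , k) C(n+2 , k+1) C(n+2 , k+2) / (C(n+2 , 1) C(n+2 , 2)).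
module Submission where

open import Defs
open import Data.Empty using (⊥; ⊥-elim)
open import Data.Integer.Base using (ℤ; +_; -[1+_]; +0; 0ℤ; 1ℤ; -1ℤ; _+_; _*_; _-_; -_)
  renaming (suc to sucℤ; pred to predℤ)
open import Data.Integer.Properties using (+-comm; +-assoc; +-identityˡ; +-identityʳ; +-injective; *-comm; *-assoc; *-identityˡ; *-zeroʳ; *-distribˡ-+; *-distribʳ-+; *-cancelˡ-≡; neg-distrib-+; neg-involutive; suc-pred; pred-suc; pos-*)
open import Data.Integer.Tactic.RingSolver using (solve-∀)
open import Data.List.Base using (List; []; _∷_; _++_; _∷ʳ_; length; map; foldr; upTo; applyUpTo)
open import Data.List.Membership.Propositional using (_∈_)
open import Data.List.Membership.Propositional.Properties using (∈-map⁺; ∈-map⁻; ∈-++⁺ˡ; ∈-++⁺ʳ; ∈-++⁻)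
open import Data.List.Properties using (length-map; length-++; map-upTo; ∷-injectiveʳ)
open import Data.List.Relation.Unary.All as All using (All; []; _∷_)
open import Data.List.Relation.Unary.AllPairs using ([]; _∷_)
open import Data.List.Relation.Unary.Any using (here; there)
open import Data.List.Relation.Unary.Unique.Propositional using (Unique)
open import Data.Nat.Base as ℕ using (ℕ; zero; suc)
open import Data.Nat.Combinatorics using (_C_; nC1≡n; nCk+nC[k+1]≡[n+1]C[k+1]; k>n⇒nCk≡0)
open import Data.Nat.DivMod using (m*n/n≡m)
open import Data.Nat.ListAction using (sum)
open import Data.Product.Base using (_×_; ∃; ∃-syntax; _,_; proj₂)
open import Data.Sum.Base using (_⊎_; inj₁; inj₂)
open import Data.Unit.Base using (tt)
open import Function.Base using (_∘_)
open import Function.Bundles using (_⇔_; mk⇔; module Equivalence)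
open import Relation.Binary.PropositionalEquality using (_≡_; refl; sym; trans; cong; cong₂; subst; module ≡-Reasoning)
import Data.List.Relation.Unary.Unique.Propositional.Properties as Unique
import Data.Nat.Properties as ℕ

open ≡-Reasoning
open Equivalence using (to; from)

-- Unrestricted walks on the lattice plane x + y + z = 0.

-- The shape (a , b) is placed at (a + 2 , b + 1 , −(a + b + 3)); the shift makes the reflections linear.
Field : Set
Field = ℤ → ℤ → ℤ → ℤ

infix  4 _≗₃_
_≗₃_ : Field → Field → Set
f ≗₃ g = ∀ x y z → f x y z ≡ g x y z

-- Opaque, so that Agda can read off the neighbouring values by unification.
opaque
  total : (m a b c d e f : ℤ) → ℤ
  total m a b c d e f = m + m + (a + b + c + d + e + f)

  total-def : ∀ m a b c d e f → total m a b c d e f ≡ m + m + (a + b + c + d + e + f)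
  total-def m a b c d e f = refl

  total-swap₁₂ : ∀ m a b c d e f → total m a b c d e f ≡ total m c d a b f e
  total-swap₁₂ = reorder
    where
    reorder : ∀ m a b c d e f → m + m + (a + b + c + d + e + f) ≡ m + m + (c + d + a + b + f + e)
    reorder = solve-∀

  total-swap₂₃ : ∀ m a b c d e f → total m a b c d e f ≡ total m e f d c a b
  total-swap₂₃ = reorder
    where
    reorder : ∀ m a b c d e f → m + m + (a + b + c + d + e + f) ≡ m + m + (e + f + d + c + a + b)
    reorder = solve-∀

  total-negate : ∀ m a b c d e f → total m a b c d e f ≡ total m b a d c f e
  total-negate = reorder
    where
    reorder : ∀ m a b c d e f → m + m + (a + b + c + d + e + f) ≡ m + m + (b + a + d + c + f + e)
    reorder = solve-∀

  total-+ : ∀ m a b c d e f m′ a′ b′ c′ d′ e′ f′ →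
    total (m + m′) (a + a′) (b + b′) (c + c′) (d + d′) (e + e′) (f + f′)
    ≡ total m a b c d e f + total m′ a′ b′ c′ d′ e′ f′
  total-+ = reorder
    where
    reorder : ∀ m a b c d e f m′ a′ b′ c′ d′ e′ f′ →
      (m + m′) + (m + m′) + ((a + a′) + (b + b′) + (c + c′) + (d + d′) + (e + e′) + (f + f′))
      ≡ (m + m + (a + b + c + d + e + f)) + (m′ + m′ + (a′ + b′ + c′ + d′ + e′ + f′))
    reorder = solve-∀

  total-- : ∀ m a b c d e f m′ a′ b′ c′ d′ e′ f′ →
    total (m - m′) (a - a′) (b - b′) (c - c′) (d - d′) (e - e′) (f - f′)
    ≡ total m a b c d e f - total m′ a′ b′ c′ d′ e′ f′
  total-- = reorder
    where
    reorder : ∀ m a b c d e f m′ a′ b′ c′ d′ e′ f′ →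
      (m - m′) + (m - m′) + ((a - a′) + (b - b′) + (c - c′) + (d - d′) + (e - e′) + (f - f′))
      ≡ (m + m + (a + b + c + d + e + f)) - (m′ + m′ + (a′ + b′ + c′ + d′ + e′ + f′))
    reorder = solve-∀

step : Field → Field
step f x y z = total (f x y z)
  (f (sucℤ x) y (predℤ z)) (f (predℤ x) y (sucℤ z))
  (f x (sucℤ y) (predℤ z)) (f x (predℤ y) (sucℤ z))
  (f (sucℤ x) (predℤ y) z) (f (predℤ x) (sucℤ y) z)

-- At a point p, `walk n f` is the sum of `f` over the endpoints of all n-step walks that start at
-- p, loops counted twice.
walk : ℕ → Field → Field
walk zero    f = f
walk (suc n) f = step (walk n f)

cong₃ : (f : Field) {x x′ y y′ z z′ : ℤ} → x ≡ x′ → y ≡ y′ → z ≡ z′ → f x y z ≡ f x′ y′ z′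
cong₃ f refl refl refl = refl

total-cong : ∀ {m a b c d e f m′ a′ b′ c′ d′ e′ f′ : ℤ} →
  m ≡ m′ → a ≡ a′ → b ≡ b′ → c ≡ c′ → d ≡ d′ → e ≡ e′ → f ≡ f′ →
  total m a b c d e f ≡ total m′ a′ b′ c′ d′ e′ f′
total-cong refl refl refl refl refl refl refl = refl

-- Fields are defined on all of ℤ³, but `ray` ignores z while `origin` tests it, so identities
-- relating the two hold on the plane x + y + z = 0. Every root preserves this plane, hence so does
-- `step`.
OnPlane : Field → Field → Set
OnPlane f g = ∀ x y z → x + y + z ≡ 0ℤ → f x y z ≡ g x y z

step-onPlane : ∀ {f g} → OnPlane f g → OnPlane (step f) (step g)
step-onPlane e x y z s = total-cong (e _ _ _ s)
  (e _ _ _ (trans (move₁ x y z) s)) (e _ _ _ (trans (move₂ x y z) s))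
  (e _ _ _ (trans (move₃ x y z) s)) (e _ _ _ (trans (move₄ x y z) s))
  (e _ _ _ (trans (move₅ x y z) s)) (e _ _ _ (trans (move₆ x y z) s))
  where
  move₁ : ∀ x y z → (1ℤ + x) + y + (-1ℤ + z) ≡ x + y + z
  move₁ = solve-∀
  move₂ : ∀ x y z → (-1ℤ + x) + y + (1ℤ + z) ≡ x + y + z
  move₂ = solve-∀
  move₃ : ∀ x y z → x + (1ℤ + y) + (-1ℤ + z) ≡ x + y + z
  move₃ = solve-∀
  move₄ : ∀ x y z → x + (-1ℤ + y) + (1ℤ + z) ≡ x + y + z
  move₄ = solve-∀
  move₅ : ∀ x y z → (1ℤ + x) + (-1ℤ + y) + z ≡ x + y + z
  move₅ = solve-∀
  move₆ : ∀ x y z → (-1ℤ + x) + (1ℤ + y) + z ≡ x + y + z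
  move₆ = solve-∀

walk-onPlane : ∀ n {f g} → OnPlane f g → OnPlane (walk n f) (walk n g)
walk-onPlane zero    e = e
walk-onPlane (suc n) e = step-onPlane (walk-onPlane n e)

step-cong : ∀ {f g} → f ≗₃ g → step f ≗₃ step g
step-cong e x y z = total-cong (e _ _ _) (e _ _ _) (e _ _ _) (e _ _ _) (e _ _ _) (e _ _ _) (e _ _ _)

-- The action of G₂ = S₃ × {±1} on fields and its commutation with walking.

swap₁₂ swap₂₃ negate : Field → Field
swap₁₂ f x y z = f y x z
swap₂₃ f x y z = f x z y
negate f x y z = f (- x) (- y) (- z)

step-swap₁₂ : ∀ f → step (swap₁₂ f) ≗₃ swap₁₂ (step f)
step-swap₁₂ f x y z = total-swap₁₂ _ _ _ _ _ _ _

step-swap₂₃ : ∀ f → step (swap₂₃ f) ≗₃ swap₂₃ (step f)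
step-swap₂₃ f x y z = total-swap₂₃ _ _ _ _ _ _ _

neg-suc : ∀ x → - sucℤ x ≡ predℤ (- x)
neg-suc = neg-distrib-+ 1ℤ

neg-pred : ∀ x → - predℤ x ≡ sucℤ (- x)
neg-pred = neg-distrib-+ -1ℤ

step-negate : ∀ f → step (negate f) ≗₃ negate (step f)
step-negate f x y z = trans
  (total-cong refl
    (cong₃ f (neg-suc x) refl (neg-pred z)) (cong₃ f (neg-pred x) refl (neg-suc z))
    (cong₃ f refl (neg-suc y) (neg-pred z)) (cong₃ f refl (neg-pred y) (neg-suc z))
    (cong₃ f (neg-suc x) (neg-pred y) refl) (cong₃ f (neg-pred x) (neg-suc y) refl))
  (total-negate _ _ _ _ _ _ _)

-- The congruence of `T` takes the place of function extensionality, since all equalities of fields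
-- are pointwise.
walk-equivariant : (T : Field → Field) →
  (∀ {f g} → f ≗₃ g → T f ≗₃ T g) → (∀ f → step (T f) ≗₃ T (step f)) →
  ∀ n f → walk n (T f) ≗₃ T (walk n f)
walk-equivariant T T-cong step-T zero    f x y z = refl
walk-equivariant T T-cong step-T (suc n) f x y z = trans
  (step-cong (walk-equivariant T T-cong step-T n f) x y z) (step-T (walk n f) x y z)


infixl 6 _⊕_ _⊝_
_⊕_ _⊝_ : Field → Field → Field
(f ⊕ g) x y z = f x y z + g x y z
(f ⊝ g) x y z = f x y z - g x y z

step-⊕ : ∀ {f f′ g g′} → step f ≗₃ f′ → step g ≗₃ g′ → step (f ⊕ g) ≗₃ f′ ⊕ g′
step-⊕ p q x y z = trans (total-+ _ _ _ _ _ _ _ _ _ _ _ _ _ _) (cong₂ _+_ (p x y z) (q x y z))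

step-⊝ : ∀ {f f′ g g′} → step f ≗₃ f′ → step g ≗₃ g′ → step (f ⊝ g) ≗₃ f′ ⊝ g′
step-⊝ p q x y z = trans (total-- _ _ _ _ _ _ _ _ _ _ _ _ _ _) (cong₂ _-_ (p x y z) (q x y z))

walk-⊝ : ∀ n f g → walk n (f ⊝ g) ≗₃ walk n f ⊝ walk n g
walk-⊝ zero    f g x y z = refl
walk-⊝ (suc n) f g x y z = trans (step-cong (walk-⊝ n f g) x y z)
  (step-⊝ {walk n f} {g = walk n g} (λ _ _ _ → refl) (λ _ _ _ → refl) x y z)

-- Antisymmetrisation over G₂ and the reflection principle

-- The signs are those of S₃. Together with `symmetrise`, where -1 gets the sign + because it is a
-- rotation of the plane by a half turn, they give the determinant character of G₂.
alternate : Field → Field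
alternate g = g ⊝ swap₁₂ g ⊝ swap₁₂ (swap₂₃ (swap₁₂ g)) ⊝ swap₂₃ g
                ⊕ swap₁₂ (swap₂₃ g) ⊕ swap₂₃ (swap₁₂ g)

step-alternate : ∀ g → step (alternate g) ≗₃ alternate (step g)
step-alternate g =
  step-⊕ (step-⊕ (step-⊝ (step-⊝ (step-⊝ {g}
    (λ _ _ _ → refl)
    (step-swap₁₂ g))
    (λ x y z → trans (step-swap₁₂ (swap₂₃ (swap₁₂ g)) x y z)
                 (trans (step-swap₂₃ (swap₁₂ g) y x z) (step-swap₁₂ g y z x))))
    (step-swap₂₃ g))
    (λ x y z → trans (step-swap₁₂ (swap₂₃ g) x y z) (step-swap₂₃ g y x z)))
    (λ x y z → trans (step-swap₂₃ (swap₁₂ g) x y z) (step-swap₁₂ g x z y))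

symmetrise : Field → Field
symmetrise f = f ⊕ negate f

step-symmetrise : ∀ f → step (symmetrise f) ≗₃ symmetrise (step f)
step-symmetrise f = step-⊕ {f} (λ _ _ _ → refl) (step-negate f)

isZero : ℤ → ℤ
isZero +0 = 1ℤ
isZero _  = 0ℤ

isAbove1 : ℤ → ℤ
isAbove1 (+ suc (suc _)) = 1ℤ
isAbove1 _               = 0ℤ

origin : Field
origin x y z = isZero x * isZero y * isZero z

-- The one-row shapes (m , 0), in shifted coordinates.
ray : Field
ray x y z = isZero (predℤ y) * isAbove1 x

-- Antisymmetrising after the walk makes the sign change under each reflection a mere reordering of
-- the twelve terms; the commutation of `step` with G₂ then enters through the recursion
-- `rayCount-suc`.
rayCount : ℕ → Field
rayCount n = alternate (symmetrise (walk n ray))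

rayCount-suc : ∀ n → rayCount (suc n) ≗₃ step (rayCount n)
rayCount-suc n x y z = sym (trans (step-alternate (symmetrise (walk n ray)) x y z)
  (alternate-cong (step-symmetrise (walk n ray)) x y z))
  where
  alternate-cong : ∀ {f g} → f ≗₃ g → alternate f ≗₃ alternate g
  alternate-cong e x y z = cong₂ _+_ (cong₂ _+_ (cong₂ _-_ (cong₂ _-_ (cong₂ _-_
    (e x y z) (e y x z)) (e z y x)) (e x z y)) (e y z x)) (e z x y)

rayCount-swap₁₂ : ∀ n x y z → rayCount n y x z ≡ - rayCount n x y z
rayCount-swap₁₂ n x y z = reorder (g x y z) (g y x z) (g z y x) (g x z y) (g y z x) (g z x y)
  where
  g = symmetrise (walk n ray)
  reorder : ∀ a b c d e f → b - a - f - e + d + c ≡ - (a - b - c - d + e + f)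
  reorder = solve-∀

-- The map is -1 composed with the transposition of x and z, which on the plane is the reflection in
-- the wall y = 0. Its fixed points there are the (x , 0 , -x), where `rayCount` must therefore
-- vanish.
rayCount-opposite : ∀ n x y z → rayCount n (- z) (- y) (- x) ≡ - rayCount n x y z
rayCount-opposite n x y z = trans
  (cong₂ _+_ (cong₂ _+_ (cong₂ _-_ (cong₂ _-_ (cong₂ _-_
    (even z y x) (even y z x)) (even x y z)) (even z x y)) (even y x z)) (even x z y))
  (reorder (g x y z) (g y x z) (g z y x) (g x z y) (g y z x) (g z x y))
  where
  f = walk n ray
  g = symmetrise f
  even : ∀ x y z → g (- x) (- y) (- z) ≡ g x y z
  even x y z = trans
    (cong (λ t → f (- x) (- y) (- z) + t) (cong₃ f (neg-involutive x) (neg-involutive y) (neg-involutive z)))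
    (+-comm (f (- x) (- y) (- z)) (f x y z))
  reorder : ∀ a b c d e f → c - e - a - f + b + d ≡ - (a - b - c - d + e + f)
  reorder = solve-∀

i≡-i⇒i≡0 : ∀ {i} → i ≡ - i → i ≡ 0ℤ
i≡-i⇒i≡0 {+0} _ = refl

rayCount-diagonal : ∀ n x z → rayCount n x x z ≡ 0ℤ
rayCount-diagonal n x z = i≡-i⇒i≡0 (rayCount-swap₁₂ n x x z)

rayCount-bottom : ∀ n x → rayCount n x 0ℤ (- x) ≡ 0ℤ
rayCount-bottom n x = i≡-i⇒i≡0 (trans
  (cong (λ t → rayCount n t 0ℤ (- x)) (sym (neg-involutive x)))
  (rayCount-opposite n x 0ℤ (- x)))

rowWalks : ℕ → ℕ → ℕ → ℤ
rowWalks n a b = rayCount n (+ suc (suc a)) (+ suc b) -[1+ suc (suc (a ℕ.+ b)) ]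

-- Free walks and telescoping along rays

translate : ℤ → ℤ → ℤ → Field → Field
translate a b c f x y z = f (a + x) (b + y) (c + z)

step-translate : ∀ a b c f → step (translate a b c f) ≗₃ translate a b c (step f)
step-translate a b c f x y z = total-cong refl
  (cong₃ f (exchange a 1ℤ x) refl (exchange c -1ℤ z)) (cong₃ f (exchange a -1ℤ x) refl (exchange c 1ℤ z))
  (cong₃ f refl (exchange b 1ℤ y) (exchange c -1ℤ z)) (cong₃ f refl (exchange b -1ℤ y) (exchange c 1ℤ z))
  (cong₃ f (exchange a 1ℤ x) (exchange b -1ℤ y) refl) (cong₃ f (exchange a -1ℤ x) (exchange b 1ℤ y) refl)
  where
  exchange : ∀ i j k → i + (j + k) ≡ j + (i + k)
  exchange = solve-∀

freeWalks rayWalks : ℕ → Field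
freeWalks n = walk n origin
rayWalks  n = walk n ray

walk-cong : ∀ n {f g} → f ≗₃ g → walk n f ≗₃ walk n g
walk-cong zero    e = e
walk-cong (suc n) e = step-cong (walk-cong n e)

freeWalks-swap₁₂ : ∀ n x y z → freeWalks n x y z ≡ freeWalks n y x z
freeWalks-swap₁₂ n x y z = trans
  (walk-cong n (λ x y z → cong (_* isZero z) (*-comm (isZero x) (isZero y))) x y z)
  (walk-equivariant swap₁₂ (λ e x y z → e y x z) step-swap₁₂ n origin x y z)

freeWalks-swap₂₃ : ∀ n x y z → freeWalks n x y z ≡ freeWalks n x z y
freeWalks-swap₂₃ n x y z = trans
  (walk-cong n (λ x y z → reorder (isZero x) (isZero y) (isZero z)) x y z)
  (walk-equivariant swap₂₃ (λ e x y z → e x z y) step-swap₂₃ n origin x y z)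
  where
  reorder : ∀ a b c → a * b * c ≡ a * c * b
  reorder = solve-∀

freeWalks-negate : ∀ n x y z → freeWalks n x y z ≡ freeWalks n (- x) (- y) (- z)
freeWalks-negate n x y z = trans
  (walk-cong n (λ x y z → cong₂ _*_ (cong₂ _*_ (isZero-neg x) (isZero-neg y)) (isZero-neg z)) x y z)
  (walk-equivariant negate (λ e x y z → e (- x) (- y) (- z)) step-negate n origin x y z)
  where
  isZero-neg : ∀ i → isZero i ≡ isZero (- i)
  isZero-neg +0          = refl
  isZero-neg (+ suc _)   = refl
  isZero-neg -[1+ _ ]    = refl

-- Moving the ray by (1 , 0 , -1) removes just its first point (2 , 1 , -3), which is the empty
-- shape. A translate of `origin` by (a , b , c) is supported at (-a , -b , -c), whence the signs.
ray-endpoint : OnPlane (ray ⊝ translate -1ℤ 0ℤ 1ℤ ray) (translate (- + 2) -1ℤ (+ 3) origin)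
ray-endpoint x y z s = begin
  isZero (predℤ y) * isAbove1 x - isZero (predℤ (0ℤ + y)) * isAbove1 (predℤ x)
    ≡⟨ cong (λ t → isZero (predℤ y) * isAbove1 x - isZero (predℤ t) * isAbove1 (predℤ x)) (+-identityˡ y) ⟩
  isZero (predℤ y) * isAbove1 x - isZero (predℤ y) * isAbove1 (predℤ x)
    ≡⟨ factor (isZero (predℤ y)) (isAbove1 x) (isAbove1 (predℤ x)) ⟩
  (isAbove1 x - isAbove1 (predℤ x)) * isZero (predℤ y)
    ≡⟨ cong (_* isZero (predℤ y)) (isAbove1-step x) ⟩
  isZero (- + 2 + x) * isZero (predℤ y)
    ≡⟨ isZero-third (- + 2 + x) (predℤ y) (+ 3 + z) (trans (shift x y z) s) ⟩
  isZero (- + 2 + x) * isZero (predℤ y) * isZero (+ 3 + z) ∎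
  where
  factor : ∀ a b c → a * b - a * c ≡ (b - c) * a
  factor = solve-∀
  shift : ∀ x y z → (- + 2 + x) + (-1ℤ + y) + (+ 3 + z) ≡ x + y + z
  shift = solve-∀
  isAbove1-step : ∀ i → isAbove1 i - isAbove1 (predℤ i) ≡ isZero (- + 2 + i)
  isAbove1-step +0                      = refl
  isAbove1-step (+ 1)                   = refl
  isAbove1-step (+ 2)                   = refl
  isAbove1-step (+ suc (suc (suc _)))   = refl
  isAbove1-step -[1+ _ ]                = refl
  isZero-third : ∀ i j k → i + j + k ≡ 0ℤ → isZero i * isZero j ≡ isZero i * isZero j * isZero k
  isZero-third +0        +0        k e rewrite trans (sym (+-identityˡ k)) e = refl
  isZero-third +0        (+ suc _) k e = refl
  isZero-third +0        -[1+ _ ]  k e = refl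
  isZero-third (+ suc _) j         k e = refl
  isZero-third -[1+ _ ]  j         k e = refl

-- Walking is linear and translation invariant, so `ray-endpoint` becomes a recursion in the
-- starting point: a walk to the ray either ends at its first point or at one of the later ones, and
-- moving the latter back by one unit restores the whole ray.
rayWalks-endpoint : ∀ n x y z → x + y + z ≡ 0ℤ →
  rayWalks n x y z ≡ freeWalks n (- + 2 + x) (-1ℤ + y) (+ 3 + z) + rayWalks n (-1ℤ + x) (0ℤ + y) (1ℤ + z)
rayWalks-endpoint n x y z s = begin
  rayWalks n x y z
    ≡⟨ split (rayWalks n x y z) (shifted x y z) ⟩
  (rayWalks n ⊝ shifted) x y z + shifted x y z
    ≡⟨ cong (λ t → rayWalks n x y z - t + shifted x y z) (
         (walk-equivariant (translate -1ℤ 0ℤ 1ℤ) (λ e _ _ _ → e _ _ _) (step-translate -1ℤ 0ℤ 1ℤ) n ray x y z)) ⟨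
  (rayWalks n ⊝ walk n (translate -1ℤ 0ℤ 1ℤ ray)) x y z + shifted x y z
    ≡⟨ cong (_+ shifted x y z) (walk-⊝ n ray (translate -1ℤ 0ℤ 1ℤ ray) x y z) ⟨
  walk n (ray ⊝ translate -1ℤ 0ℤ 1ℤ ray) x y z + shifted x y z
    ≡⟨ cong (_+ shifted x y z) (walk-onPlane n ray-endpoint x y z s) ⟩
  walk n (translate (- + 2) -1ℤ (+ 3) origin) x y z + shifted x y z
    ≡⟨ cong (_+ shifted x y z)
         (walk-equivariant (translate (- + 2) -1ℤ (+ 3)) (λ e _ _ _ → e _ _ _) (step-translate (- + 2) -1ℤ (+ 3)) n origin x y z) ⟩
  freeWalks n (- + 2 + x) (-1ℤ + y) (+ 3 + z) + shifted x y z ∎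
  where
  shifted = translate -1ℤ 0ℤ 1ℤ (rayWalks n)
  split : ∀ a b → a ≡ a - b + b
  split = solve-∀

raySegment rayRest : ℕ → ℕ → Field
raySegment n zero    x y z = 0ℤ
raySegment n (suc l) x y z = freeWalks n (- + 2 + x) (-1ℤ + y) (+ 3 + z) + raySegment n l (-1ℤ + x) (0ℤ + y) (1ℤ + z)
rayRest    n zero    x y z = rayWalks n x y z
rayRest    n (suc l) x y z = rayRest n l (-1ℤ + x) (0ℤ + y) (1ℤ + z)

rayWalks-split : ∀ n l x y z → x + y + z ≡ 0ℤ → rayWalks n x y z ≡ raySegment n l x y z + rayRest n l x y z
rayWalks-split n zero    x y z s = sym (+-identityˡ _)
rayWalks-split n (suc l) x y z s = begin
  rayWalks n x y z
    ≡⟨ rayWalks-endpoint n x y z s ⟩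
  a + rayWalks n (-1ℤ + x) (0ℤ + y) (1ℤ + z)
    ≡⟨ cong (λ t → a + t) (rayWalks-split n l (-1ℤ + x) (0ℤ + y) (1ℤ + z) (trans (shift x y z) s)) ⟩
  a + (b + c)
    ≡⟨ +-assoc a b c ⟨
  a + b + c ∎
  where
  a = freeWalks n (- + 2 + x) (-1ℤ + y) (+ 3 + z)
  b = raySegment n l (-1ℤ + x) (0ℤ + y) (1ℤ + z)
  c = rayRest n l (-1ℤ + x) (0ℤ + y) (1ℤ + z)
  shift : ∀ x y z → (-1ℤ + x) + (0ℤ + y) + (1ℤ + z) ≡ x + y + z
  shift = solve-∀

-- The twelve rays lie in pairs of opposite sign on six lines, so all but finitely many terms cancel.
rowWalks-origin : ∀ n → rowWalks n 0 0 ≡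
    freeWalks n (+ 0) (+ 0) (+ 0)
  - freeWalks n (- + 2) (+ 1) (+ 1) - freeWalks n (+ 1) (- + 2) (+ 1)
  + freeWalks n (- + 3) (+ 0) (+ 3) + freeWalks n (+ 0) (- + 3) (+ 3)
  - freeWalks n (- + 2) (- + 2) (+ 4)
rowWalks-origin n = trans
  (telescope
    -- The lengths 5, 4, 5, 1, 4, 1 are the distances, in units of (-1 , 0 , 1), between the two
    -- among the twelve starting points that lie on a common line. After that many terms each rest
    -- is the ray count at the second point, which has the opposite sign; 5 + 4 + 5 + 1 + 4 + 1 = 20
    -- free terms remain.
    {s₁ = S 5 (+ 2) (+ 1) (- + 3)} {S 4 (+ 1) (+ 2) (- + 3)} {S 5 (+ 3) (- + 1) (- + 2)}
    {S 1 (- + 1) (+ 3) (- + 2)} {S 4 (+ 3) (- + 2) (- + 1)} {S 1 (+ 2) (- + 3) (+ 1)}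
    {Q 5 (+ 2) (+ 1) (- + 3)} {Q 4 (+ 1) (+ 2) (- + 3)} {Q 5 (+ 3) (- + 1) (- + 2)}
    {Q 1 (- + 1) (+ 3) (- + 2)} {Q 4 (+ 3) (- + 2) (- + 1)} {Q 1 (+ 2) (- + 3) (+ 1)}
    (rayWalks-split n 5 (+ 2) (+ 1) (- + 3) refl)
    (rayWalks-split n 4 (+ 1) (+ 2) (- + 3) refl)
    (rayWalks-split n 5 (+ 3) (- + 1) (- + 2) refl)
    (rayWalks-split n 1 (- + 1) (+ 3) (- + 2) refl)
    (rayWalks-split n 4 (+ 3) (- + 2) (- + 1) refl)
    (rayWalks-split n 1 (+ 2) (- + 3) (+ 1) refl))
  (cancel {o = A (+ 0) (+ 0) (+ 0)} {a9 = A (- + 3) (+ 0) (+ 3)} {A (- + 2) (+ 1) (+ 1)} {A (+ 1) (- + 2) (+ 1)}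
          {A (- + 2) (- + 2) (+ 4)} {A (+ 0) (- + 3) (+ 3)}
    -- Seven pairs among the twenty endpoints lie in a common G₂-orbit and have opposite signs, so
    -- that six terms are left.
    (freeWalks-swap₂₃ n (- + 1) (+ 0) (+ 1))
    (freeWalks-swap₁₂ n (- + 2) (+ 0) (+ 2))
    (freeWalks-swap₁₂ n (- + 4) (+ 0) (+ 4))
    (freeWalks-swap₂₃ n (- + 3) (+ 1) (+ 2))
    (trans (freeWalks-negate n (- + 1) (- + 2) (+ 3)) (freeWalks-swap₂₃ n (+ 1) (+ 2) (- + 3)))
    (trans (freeWalks-negate n (- + 4) (+ 1) (+ 3))
      (trans (freeWalks-swap₁₂ n (+ 4) (- + 1) (- + 3)) (freeWalks-swap₂₃ n (- + 1) (+ 4) (- + 3))))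
    (freeWalks-swap₁₂ n (- + 3) (- + 2) (+ 5)))
  where
  A = freeWalks n
  S = raySegment n
  Q = rayRest n
  telescope : ∀ {p₁ p₂ p₃ p₄ p₅ p₆ s₁ s₂ s₃ s₄ s₅ s₆ q₁ q₂ q₃ q₄ q₅ q₆ : ℤ} →
    p₁ ≡ s₁ + q₁ → p₂ ≡ s₂ + q₂ → p₃ ≡ s₃ + q₃ → p₄ ≡ s₄ + q₄ → p₅ ≡ s₅ + q₅ → p₆ ≡ s₆ + q₆ →
    (p₁ + q₃) - (p₂ + q₅) - (q₁ + p₃) - (p₆ + q₄) + (q₆ + p₄) + (q₂ + p₅)
    ≡ s₁ - s₂ - s₃ + s₄ + s₅ - s₆
  telescope {s₁ = s₁} {s₂} {s₃} {s₄} {s₅} {s₆} {q₁} {q₂} {q₃} {q₄} {q₅} {q₆} refl refl refl refl refl refl =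
    ring s₁ s₂ s₃ s₄ s₅ s₆ q₁ q₂ q₃ q₄ q₅ q₆
    where
    ring : ∀ s₁ s₂ s₃ s₄ s₅ s₆ q₁ q₂ q₃ q₄ q₅ q₆ →
      (s₁ + q₁ + q₃) - (s₂ + q₂ + q₅) - (q₁ + (s₃ + q₃)) - (s₆ + q₆ + q₄) + (q₆ + (s₄ + q₄)) + (q₂ + (s₅ + q₅))
      ≡ s₁ - s₂ - s₃ + s₄ + s₅ - s₆
    ring = solve-∀
  -- The digits in a name are the squared length x² + x y + y² of the endpoint.
  cancel : ∀ {o a9 b3 c3 c12 e9 a1 b1 a4 c4 a16 f16 b7 d7 c7 e7 b13 e13 c19 e19 : ℤ} →
    a1 ≡ b1 → a4 ≡ c4 → a16 ≡ f16 → b7 ≡ d7 → c7 ≡ e7 → b13 ≡ e13 → c19 ≡ e19 →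
      (o + (a1 + (a4 + (a9 + (a16 + 0ℤ))))) - (b1 + (b3 + (b7 + (b13 + 0ℤ))))
    - (c3 + (c4 + (c7 + (c12 + (c19 + 0ℤ))))) + (d7 + 0ℤ) + (e7 + (e9 + (e13 + (e19 + 0ℤ)))) - (f16 + 0ℤ)
    ≡ o - b3 - c3 + a9 + e9 - c12
  cancel {o} {a9} {b3} {c3} {c12} {e9} {a1} {_} {a4} {_} {a16} {_} {b7} {_} {c7} {_} {b13} {_} {c19} refl refl refl refl refl refl refl =
    ring o a9 b3 c3 c12 e9 a1 a4 a16 b7 c7 b13 c19
    where
    ring : ∀ o a9 b3 c3 c12 e9 a1 a4 a16 b7 c7 b13 c19 →
        (o + (a1 + (a4 + (a9 + (a16 + 0ℤ))))) - (a1 + (b3 + (b7 + (b13 + 0ℤ))))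
      - (c3 + (a4 + (c7 + (c12 + (c19 + 0ℤ))))) + (b7 + 0ℤ) + (c7 + (e9 + (b13 + (c19 + 0ℤ)))) - (a16 + 0ℤ)
      ≡ o - b3 - c3 + a9 + e9 - c12
    ring = solve-∀

-- Free walks as sums of products of binomial coefficients

sumBelow : ℕ → (ℕ → ℤ) → ℤ
sumBelow zero    f = 0ℤ
sumBelow (suc N) f = f 0 + sumBelow N (f ∘ suc)

sumBelow-cong : ∀ N {f g} → (∀ k → k ℕ.< N → f k ≡ g k) → sumBelow N f ≡ sumBelow N g
sumBelow-cong zero    e = refl
sumBelow-cong (suc N) e = cong₂ _+_ (e 0 ℕ.z<s) (sumBelow-cong N (λ k k<N → e (suc k) (ℕ.s<s k<N)))

sumBelow-snoc : ∀ N f → sumBelow (suc N) f ≡ sumBelow N f + f N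
sumBelow-snoc zero    f = +-comm (f 0) 0ℤ
sumBelow-snoc (suc N) f = trans (cong (λ t → f 0 + t) (sumBelow-snoc N (f ∘ suc))) (sym (+-assoc (f 0) _ _))

sumBelow-shift : ∀ N f → f 0 ≡ 0ℤ → f N ≡ 0ℤ → sumBelow N (f ∘ suc) ≡ sumBelow N f
sumBelow-shift N f f0 fN = begin
  sumBelow N (f ∘ suc)        ≡⟨ +-identityˡ _ ⟨
  0ℤ + sumBelow N (f ∘ suc)   ≡⟨ cong (_+ sumBelow N (f ∘ suc)) f0 ⟨
  sumBelow (suc N) f          ≡⟨ sumBelow-snoc N f ⟩
  sumBelow N f + f N          ≡⟨ cong (λ t → sumBelow N f + t) fN ⟩
  sumBelow N f + 0ℤ           ≡⟨ +-identityʳ _ ⟩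
  sumBelow N f                ∎

sumBelow-+ : ∀ N f g → sumBelow N (λ k → f k + g k) ≡ sumBelow N f + sumBelow N g
sumBelow-+ zero    f g = refl
sumBelow-+ (suc N) f g = trans (cong (λ t → f 0 + g 0 + t) (sumBelow-+ N (f ∘ suc) (g ∘ suc))) (reorder (f 0) (g 0) _ _)
  where
  reorder : ∀ a b c d → a + b + (c + d) ≡ a + c + (b + d)
  reorder = solve-∀

sumBelow-- : ∀ N f g → sumBelow N (λ k → f k - g k) ≡ sumBelow N f - sumBelow N g
sumBelow-- zero    f g = refl
sumBelow-- (suc N) f g = trans (cong (λ t → f 0 - g 0 + t) (sumBelow-- N (f ∘ suc) (g ∘ suc))) (reorder (f 0) (g 0) _ _)
  where
  reorder : ∀ a b c d → a - b + (c - d) ≡ a + c - (b + d)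
  reorder = solve-∀

sumBelow-total : ∀ N m a b c d e f →
  sumBelow N (λ k → total (m k) (a k) (b k) (c k) (d k) (e k) (f k)) ≡
  total (sumBelow N m) (sumBelow N a) (sumBelow N b) (sumBelow N c) (sumBelow N d) (sumBelow N e) (sumBelow N f)
sumBelow-total zero    m a b c d e f = sym (total-def 0ℤ 0ℤ 0ℤ 0ℤ 0ℤ 0ℤ 0ℤ)
sumBelow-total (suc N) m a b c d e f = trans
  (cong (λ t → total (m 0) (a 0) (b 0) (c 0) (d 0) (e 0) (f 0) + t)
    (sumBelow-total N (m ∘ suc) (a ∘ suc) (b ∘ suc) (c ∘ suc) (d ∘ suc) (e ∘ suc) (f ∘ suc)))
  (sym (total-+ _ _ _ _ _ _ _ _ _ _ _ _ _ _))

-- Binomial coefficients with an integer lower index, 0 when it is negative.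
binom : ℕ → ℤ → ℤ
binom n (+ k)    = + (n C k)
binom n -[1+ _ ] = 0ℤ

pascal : ∀ n i → binom (suc n) i ≡ binom n i + binom n (predℤ i)
pascal n +0        = refl
pascal n (+ suc k) = cong +_ (trans (sym (nCk+nC[k+1]≡[n+1]C[k+1] n k)) (ℕ.+-comm (n C k) (n C suc k)))
pascal n -[1+ k ]  = refl

pascal-suc : ∀ n i → binom (suc n) (sucℤ i) ≡ binom n (sucℤ i) + binom n i
pascal-suc n i = trans (pascal n (sucℤ i)) (cong (λ j → binom n (sucℤ i) + binom n j) (pred-suc i))

-- Induction on n through Pascal's rule. Allowing every integer i lets the neighbours of C(n , k)
-- that fall outside the range 0, ..., n be treated like all others.
binom-absorb : ∀ n i → sucℤ i * binom n (sucℤ i) ≡ (+ n - i) * binom n i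
binom-absorb zero +0             = refl
binom-absorb zero (+ suc k)      = trans (*-zeroʳ (+ suc (suc k))) (sym (*-zeroʳ (0ℤ - + suc k)))
binom-absorb zero -[1+ 0 ]       = refl
binom-absorb zero -[1+ suc k ]   = trans (*-zeroʳ (sucℤ -[1+ suc k ])) (sym (*-zeroʳ (0ℤ - -[1+ suc k ])))
binom-absorb (suc n) i = begin
  sucℤ i * binom (suc n) (sucℤ i)
    ≡⟨ cong (sucℤ i *_) (pascal-suc n i) ⟩
  sucℤ i * (binom n (sucℤ i) + c)
    ≡⟨ *-distribˡ-+ (sucℤ i) (binom n (sucℤ i)) c ⟩
  sucℤ i * binom n (sucℤ i) + sucℤ i * c
    ≡⟨ cong (_+ sucℤ i * c) (binom-absorb n i) ⟩
  (+ n - i) * c + sucℤ i * c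
    ≡⟨ regroup (+ n) i c ⟩
  -- Writing i as the successor of its predecessor makes the second summand an instance of the
  -- induction hypothesis at i - 1.
  (sucℤ (+ n) - i) * c + i * c
    ≡⟨ cong (λ t → (sucℤ (+ n) - i) * c + t * binom n t) (suc-pred i) ⟨
  (sucℤ (+ n) - i) * c + sucℤ (predℤ i) * binom n (sucℤ (predℤ i))
    ≡⟨ cong (λ t → (sucℤ (+ n) - i) * c + t) (binom-absorb n (predℤ i)) ⟩
  (sucℤ (+ n) - i) * c + (+ n - predℤ i) * binom n (predℤ i)
    ≡⟨ collect (+ n) i c (binom n (predℤ i)) ⟩
  (+ suc n - i) * (c + binom n (predℤ i))
    ≡⟨ cong ((+ suc n - i) *_) (pascal n i) ⟨
  (+ suc n - i) * binom (suc n) i ∎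
  where
  c = binom n i
  regroup : ∀ n i c → (n - i) * c + (1ℤ + i) * c ≡ (1ℤ + n - i) * c + i * c
  regroup = solve-∀
  collect : ∀ n i c d → (1ℤ + n - i) * c + (n - (-1ℤ + i)) * d ≡ (1ℤ + n - i) * (c + d)
  collect = solve-∀

-- A free walk is three walkers making n steps 0 or 1 each; (a , b) are their successive distances.
walkers : ℕ → ℤ → ℤ → ℤ → ℤ
walkers n a b i = binom n i * (binom n (i + b) * binom n (i + (a + b)))

-- The two summands on the left are the cases in which the first walker, starting the last step at
-- i, stays or moves. Pascal's rule for the other two walkers splits each into four products. If all
-- three walkers do the same, the distances are unchanged, which is the double loop; the other six
-- products are the roots.
walkers-suc : ∀ n a b i → 
  binom n i * (binom (suc n) (i + b) * binom (suc n) (i + (a + b)))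
  + binom n i * (binom (suc n) (sucℤ i + b) * binom (suc n) (sucℤ i + (a + b)))
  ≡ total (walkers n a b i) (walkers n (sucℤ a) b i) (walkers n (predℤ a) b i)
      (walkers n a (sucℤ b) i) (walkers n a (predℤ b) i)
      (walkers n (sucℤ a) (predℤ b) i) (walkers n (predℤ a) (sucℤ b) i)
walkers-suc n a b i = begin
  c * (binom (suc n) u * binom (suc n) v) + c * (binom (suc n) (sucℤ i + b) * binom (suc n) (sucℤ i + (a + b)))
    ≡⟨ cong₂ (λ s t → c * (binom (suc n) u * binom (suc n) v) + c * (binom (suc n) s * binom (suc n) t))
         (+-assoc 1ℤ i b) (+-assoc 1ℤ i (a + b)) ⟩
  c * (binom (suc n) u * binom (suc n) v) + c * (binom (suc n) (sucℤ u) * binom (suc n) (sucℤ v))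
    ≡⟨ cong₂ (λ s t → c * s + c * t) (cong₂ _*_ (pascal n u) (pascal n v)) (cong₂ _*_ (pascal-suc n u) (pascal-suc n v)) ⟩
  c * ((u₀ + u₋) * (v₀ + v₋)) + c * ((u₊ + u₀) * (v₊ + v₀))
    ≡⟨ expand c u₋ u₀ u₊ v₋ v₀ v₊ ⟩
  _
    ≡⟨ total-def _ _ _ _ _ _ _ ⟨
  total (c * (u₀ * v₀)) (c * (u₀ * v₊)) (c * (u₀ * v₋)) (c * (u₊ * v₊)) (c * (u₋ * v₋)) (c * (u₋ * v₀)) (c * (u₊ * v₀))
    ≡⟨ total-cong refl
         (at {u} refl (sym (move₂ 1ℤ i a b))) (at {u} refl (sym (move₂ -1ℤ i a b)))
         (at (sym (move₁ 1ℤ i b)) (sym (move₃ 1ℤ i a b))) (at (sym (move₁ -1ℤ i b)) (sym (move₃ -1ℤ i a b)))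
         (at (sym (move₁ -1ℤ i b)) (sym (move₄ i a b))) (at (sym (move₁ 1ℤ i b)) (sym (move₅ i a b))) ⟩
  _ ∎
  where
  u = i + b
  v = i + (a + b)
  c = binom n i
  u₋ = binom n (predℤ u)
  u₀ = binom n u
  u₊ = binom n (sucℤ u)
  v₋ = binom n (predℤ v)
  v₀ = binom n v
  v₊ = binom n (sucℤ v)
  at : ∀ {s t s′ t′} → s ≡ s′ → t ≡ t′ → c * (binom n s * binom n t) ≡ c * (binom n s′ * binom n t′)
  at refl refl = refl
  expand : ∀ c u₋ u₀ u₊ v₋ v₀ v₊ → c * ((u₀ + u₋) * (v₀ + v₋)) + c * ((u₊ + u₀) * (v₊ + v₀)) ≡
    c * (u₀ * v₀) + c * (u₀ * v₀) + (c * (u₀ * v₊) + c * (u₀ * v₋) + c * (u₊ * v₊) + c * (u₋ * v₋) + c * (u₋ * v₀) + c * (u₊ * v₀))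
  expand = solve-∀
  move₁ : ∀ e i b → i + (e + b) ≡ e + (i + b)
  move₁ = solve-∀
  move₂ : ∀ e i a b → i + ((e + a) + b) ≡ e + (i + (a + b))
  move₂ = solve-∀
  move₃ : ∀ e i a b → i + (a + (e + b)) ≡ e + (i + (a + b))
  move₃ = solve-∀
  move₄ : ∀ i a b → i + ((1ℤ + a) + (-1ℤ + b)) ≡ i + (a + b)
  move₄ = solve-∀
  move₅ : ∀ i a b → i + ((-1ℤ + a) + (1ℤ + b)) ≡ i + (a + b)
  move₅ = solve-∀

binom-above : ∀ {n k} → n ℕ.< k → binom n (+ k) ≡ 0ℤ
binom-above n<k = cong +_ (k>n⇒nCk≡0 n<k)

-- The bound `N` is kept apart from `n` so that the recursion in `n` compares sums of equal length;
-- terms with k > n vanish.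
walkersField : ℕ → ℕ → Field
walkersField N n a b _ = sumBelow N (λ k → walkers n a b (+ k))

walkersField-suc : ∀ N n → suc n ℕ.< N → walkersField N (suc n) ≗₃ step (walkersField N n)
walkersField-suc N@(suc N′) n (ℕ.s≤s n<N′) a b z = begin
  sumBelow N (λ k → binom (suc n) (+ k) * F (+ k))
    ≡⟨ sumBelow-cong N (λ k _ → trans (cong (_* F (+ k)) (pascal n (+ k))) (*-distribʳ-+ (F (+ k)) (binom n (+ k)) (binom n (predℤ (+ k))))) ⟩
  sumBelow N (λ k → binom n (+ k) * F (+ k) + lagged k)
    ≡⟨ sumBelow-+ N (λ k → binom n (+ k) * F (+ k)) lagged ⟩
  sumBelow N (λ k → binom n (+ k) * F (+ k)) + sumBelow N lagged
    -- Reindexing by k + 1 turns the final position of a first walker that moved into its previous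
    -- one. The boundary terms vanish: the lower index is -1 at one end and N - 1 > n at the other.
    ≡⟨ cong (λ t → sumBelow N (λ k → binom n (+ k) * F (+ k)) + t)
         (sumBelow-shift N lagged refl (cong (_* F (+ N)) (binom-above n<N′))) ⟨
  sumBelow N (λ k → binom n (+ k) * F (+ k)) + sumBelow N (λ k → binom n (+ k) * F (+ suc k))
    ≡⟨ sumBelow-+ N (λ k → binom n (+ k) * F (+ k)) (λ k → binom n (+ k) * F (+ suc k)) ⟨
  sumBelow N (λ k → binom n (+ k) * F (+ k) + binom n (+ k) * F (+ suc k))
    ≡⟨ sumBelow-cong N (λ k _ → walkers-suc n a b (+ k)) ⟩
  sumBelow N (λ k → total (W a b k) (W (sucℤ a) b k) (W (predℤ a) b k) (W a (sucℤ b) k) (W a (predℤ b) k)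
                          (W (sucℤ a) (predℤ b) k) (W (predℤ a) (sucℤ b) k))
    ≡⟨ sumBelow-total N (W a b) (W (sucℤ a) b) (W (predℤ a) b) (W a (sucℤ b)) (W a (predℤ b))
         (W (sucℤ a) (predℤ b)) (W (predℤ a) (sucℤ b)) ⟩
  step (walkersField N n) a b z ∎
  where
  W : ℤ → ℤ → ℕ → ℤ
  W a b k = walkers n a b (+ k)
  F : ℤ → ℤ
  F i = binom (suc n) (i + b) * binom (suc n) (i + (a + b))
  lagged : ℕ → ℤ
  lagged k = binom n (predℤ (+ k)) * F (+ k)

-- Both sides obey the recursion given by `step`. For n = 0 all walkers stand at 0, so only k = 0
-- contributes, and it forces b = a + b = 0; the plane equation then gives c = 0 as well.
freeWalks-walkers : ∀ N n → n ℕ.< N → OnPlane (freeWalks n) (walkersField N n)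
freeWalks-walkers (suc N) zero _ a b c s = sym (begin
  binom 0 (+ 0) * (binom 0 (0ℤ + b) * binom 0 (0ℤ + (a + b))) + sumBelow N (λ k → walkers 0 a b (+ suc k))
    ≡⟨ cong₂ _+_ (trans (*-identityˡ _) (cong₂ (λ s t → binom 0 s * binom 0 t) (+-identityˡ b) (+-identityˡ (a + b)))) (vanish N 0) ⟩
  binom 0 b * binom 0 (a + b) + 0ℤ
    ≡⟨ +-identityʳ _ ⟩
  binom 0 b * binom 0 (a + b)
    ≡⟨ cong₂ _*_ (binom-zero b) (binom-zero (a + b)) ⟩
  isZero b * isZero (a + b)
    ≡⟨ supported a b c s ⟩
  isZero a * isZero b * isZero c ∎)
  where
  vanish : ∀ N j → sumBelow N (λ k → walkers 0 a b (+ suc (j ℕ.+ k))) ≡ 0ℤ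
  vanish zero    j = refl
  vanish (suc N) j = trans (+-identityˡ _)
    (trans (sumBelow-cong N (λ k _ → cong (λ t → walkers 0 a b (+ suc t)) (ℕ.+-suc j k))) (vanish N (suc j)))
  binom-zero : ∀ i → binom 0 i ≡ isZero i
  binom-zero +0        = refl
  binom-zero (+ suc _) = refl
  binom-zero -[1+ _ ]  = refl
  supported : ∀ a b c → a + b + c ≡ 0ℤ → isZero b * isZero (a + b) ≡ isZero a * isZero b * isZero c
  supported a (+ suc _) c e = sym (cong (_* isZero c) (*-zeroʳ (isZero a)))
  supported a -[1+ _ ]  c e = sym (cong (_* isZero c) (*-zeroʳ (isZero a)))
  supported a +0 c e rewrite +-identityʳ a = onLine a c e
    where
    onLine : ∀ a c → a + c ≡ 0ℤ → 1ℤ * isZero a ≡ isZero a * 1ℤ * isZero c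
    onLine +0        c e rewrite trans (sym (+-identityˡ c)) e = refl
    onLine (+ suc _) c e = refl
    onLine -[1+ _ ]  c e = refl
freeWalks-walkers N (suc n) n<N a b c s = trans
  (step-onPlane (freeWalks-walkers N n (ℕ.<-trans (ℕ.n<1+n n) n<N)) a b c s)
  (sym (walkersField-suc N n n<N a b c))

-- The 3 × 3 Toeplitz determinant of binomial coefficients and its product formula.

-- The determinant of the 3 × 3 matrix of entries C(n , k + i − j), written out as a function of c d = C(n , k + d).
toeplitz : (ℤ → ℤ) → ℤ
toeplitz c = c (+ 0) * (c (+ 0) * c (+ 0))
  - c (+ 0) * (c (+ 1) * c (- + 1)) - c (+ 0) * (c (+ 1) * c (- + 1))
  + c (+ 1) * (c (+ 1) * c (- + 2)) + c (- + 1) * (c (- + 1) * c (+ 2))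
  - c (+ 0) * (c (+ 2) * c (- + 2))

-- For k ≤ n this is, by the Lindström-Gessel-Viennot lemma, a number of triples of non-intersecting
-- lattice paths, equal to the number of plane partitions in a box of sides k, n - k and 3.
nonCrossing : ℕ → ℕ → ℤ
nonCrossing n k = toeplitz (λ d → binom n (d + + k))

-- Every binomial coefficient involved is a rational multiple of c₀ = C(n , k), so both sides are
-- rational functions of k and m = n - k times c₀³. The factor `D` clears the denominators of the
-- three C(n+2 , ·), and 2 clears that of C(n+2 , 2).
nonCrossing-product : ∀ k m →
  + ((suc (suc (k ℕ.+ m)) C k) ℕ.* (suc (suc (k ℕ.+ m)) C suc k) ℕ.* (suc (suc (k ℕ.+ m)) C suc (suc k)))
  ≡ + ((suc (suc (k ℕ.+ m)) C 1) ℕ.* (suc (suc (k ℕ.+ m)) C 2)) * nonCrossing (k ℕ.+ m) k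
nonCrossing-product k m = *-cancelˡ-≡ (+ 2 * D) _ _ (begin
  + 2 * D * + ((suc (suc n) C k) ℕ.* (suc (suc n) C suc k) ℕ.* (suc (suc n) C suc (suc k)))
    ≡⟨ cong (+ 2 * D *_) (trans (pos-* ((suc (suc n) C k) ℕ.* (suc (suc n) C suc k)) (suc (suc n) C suc (suc k)))
         (cong (_* + (suc (suc n) C suc (suc k))) (pos-* (suc (suc n) C k) (suc (suc n) C suc k)))) ⟩
  + 2 * D * (b₀ * b₁ * b₂)
    ≡⟨ distribute K M b₀ b₁ b₂ ⟩
  + 2 * (((1ℤ + M) * (+ 2 + M) * b₀) * ((1ℤ + K) * (1ℤ + M) * b₁) * ((1ℤ + K) * (+ 2 + K) * b₂))
    ≡⟨ cong (+ 2 *_) (cong₂ _*_ (cong₂ _*_ lower middle) upper) ⟩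
  + 2 * ((N₁ * N₂ * c₀) * (N₁ * N₂ * c₀) * (N₁ * N₂ * c₀))
    ≡⟨ regroup K M c₀ ⟩
  N₂ * (N₁ * N₂) * (+ 2 * (N₁ * N₁ * N₂) * (c₀ * (c₀ * c₀)))
    ≡⟨ cong₂ (λ s t → N₂ * s * t) (sym doubleC2) (sym scaled) ⟩
  N₂ * (+ 2 * + (suc (suc n) C 2)) * (D * nonCrossing n k)
    ≡⟨ rotate N₂ (+ (suc (suc n) C 2)) D (nonCrossing n k) ⟩
  + 2 * D * (N₂ * + (suc (suc n) C 2) * nonCrossing n k)
    ≡⟨ cong (λ t → + 2 * D * (t * nonCrossing n k))
         (trans (pos-* (suc (suc n) C 1) (suc (suc n) C 2)) (cong (λ t → + t * + (suc (suc n) C 2)) (nC1≡n (suc (suc n))))) ⟨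
  + 2 * D * (+ ((suc (suc n) C 1) ℕ.* (suc (suc n) C 2)) * nonCrossing n k) ∎)
  where
  n = k ℕ.+ m
  K M N₁ N₂ D c₀ c₁ c₂ d₁ d₂ b₀ b₁ b₂ : ℤ
  K = + k
  M = + m
  N₁ = 1ℤ + (K + M)
  N₂ = + 2 + (K + M)
  D = (1ℤ + M) * (1ℤ + M) * (+ 2 + M) * ((1ℤ + K) * (1ℤ + K) * (+ 2 + K))
  c₀ = binom n K
  c₁ = binom n (sucℤ K)
  c₂ = binom n (sucℤ (sucℤ K))
  d₁ = binom n (predℤ K)
  d₂ = binom n (- + 2 + K)
  b₀ = binom (suc (suc n)) K
  b₁ = binom (suc (suc n)) (sucℤ K)
  b₂ = binom (suc (suc n)) (sucℤ (sucℤ K))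

  -- The ratios of C(n , k ± 1) and C(n , k ± 2) to C(n , k), free of fractions, by one or two
  -- absorptions.
  up₁ : (1ℤ + K) * c₁ ≡ M * c₀
  up₁ = trans (binom-absorb n K) (cong (_* c₀) (ring K M))
    where
    ring : ∀ K M → K + M - K ≡ M
    ring = solve-∀

  up₂ : (1ℤ + K) * (+ 2 + K) * c₂ ≡ M * (M - 1ℤ) * c₀
  up₂ = begin
    (1ℤ + K) * (+ 2 + K) * c₂           ≡⟨ *-assoc (1ℤ + K) (+ 2 + K) c₂ ⟩
    (1ℤ + K) * ((+ 2 + K) * c₂)         ≡⟨ cong ((1ℤ + K) *_) (binom-absorb n (sucℤ K)) ⟩
    (1ℤ + K) * ((K + M - sucℤ K) * c₁)  ≡⟨ ring₁ K M c₁ ⟩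
    (M - 1ℤ) * ((1ℤ + K) * c₁)          ≡⟨ cong ((M - 1ℤ) *_) up₁ ⟩
    (M - 1ℤ) * (M * c₀)                 ≡⟨ ring₂ M c₀ ⟩
    M * (M - 1ℤ) * c₀                   ∎
    where
    ring₁ : ∀ K M c → (1ℤ + K) * ((K + M - (1ℤ + K)) * c) ≡ (M - 1ℤ) * ((1ℤ + K) * c)
    ring₁ = solve-∀
    ring₂ : ∀ M c → (M - 1ℤ) * (M * c) ≡ M * (M - 1ℤ) * c
    ring₂ = solve-∀

  down₁ : (1ℤ + M) * d₁ ≡ K * c₀
  down₁ = begin
    (1ℤ + M) * d₁                                        ≡⟨ cong (_* d₁) (ring K M) ⟨
    (K + M - predℤ K) * d₁                               ≡⟨ binom-absorb n (predℤ K) ⟨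
    sucℤ (predℤ K) * binom n (sucℤ (predℤ K))            ≡⟨ cong (λ t → t * binom n t) (suc-pred K) ⟩
    K * c₀                                               ∎
    where
    ring : ∀ K M → K + M - (-1ℤ + K) ≡ 1ℤ + M
    ring = solve-∀

  down₂ : (1ℤ + M) * (+ 2 + M) * d₂ ≡ K * (K - 1ℤ) * c₀
  down₂ = begin
    (1ℤ + M) * (+ 2 + M) * d₂                                  ≡⟨ ring₁ K M d₂ ⟩
    (1ℤ + M) * ((K + M - (- + 2 + K)) * d₂)                    ≡⟨ cong ((1ℤ + M) *_) (binom-absorb n (- + 2 + K)) ⟨
    (1ℤ + M) * (sucℤ (- + 2 + K) * binom n (sucℤ (- + 2 + K))) ≡⟨ cong (λ t → (1ℤ + M) * (t * binom n t)) (+-assoc 1ℤ (- + 2) K) ⟨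
    (1ℤ + M) * (predℤ K * d₁)                                  ≡⟨ ring₂ K M d₁ ⟩
    (K - 1ℤ) * ((1ℤ + M) * d₁)                                 ≡⟨ cong ((K - 1ℤ) *_) down₁ ⟩
    (K - 1ℤ) * (K * c₀)                                        ≡⟨ ring₃ K c₀ ⟩
    K * (K - 1ℤ) * c₀                                          ∎
    where
    ring₁ : ∀ K M d → (1ℤ + M) * (+ 2 + M) * d ≡ (1ℤ + M) * ((K + M - (- + 2 + K)) * d)
    ring₁ = solve-∀
    ring₂ : ∀ K M d → (1ℤ + M) * ((-1ℤ + K) * d) ≡ (K - 1ℤ) * ((1ℤ + M) * d)
    ring₂ = solve-∀
    ring₃ : ∀ K c → (K - 1ℤ) * (K * c) ≡ K * (K - 1ℤ) * c
    ring₃ = solve-∀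

  -- Here and in `middle` and `upper`, two uses of Pascal's rule reduce C(n+2 , ·) to neighbours of
  -- C(n , k), and the ratios above do the rest.
  lower : (1ℤ + M) * (+ 2 + M) * b₀ ≡ N₁ * N₂ * c₀
  lower = begin
    (1ℤ + M) * (+ 2 + M) * b₀
      ≡⟨ cong ((1ℤ + M) * (+ 2 + M) *_) (trans (pascal (suc n) K) (cong₂ _+_ (pascal n K) (trans (pascal n (predℤ K))
           (cong (λ t → d₁ + binom n t) (sym (+-assoc -1ℤ -1ℤ K)))))) ⟩
    (1ℤ + M) * (+ 2 + M) * (c₀ + d₁ + (d₁ + d₂))
      ≡⟨ ring₁ M c₀ d₁ d₂ ⟩
    (1ℤ + M) * (+ 2 + M) * c₀ + + 2 * (+ 2 + M) * ((1ℤ + M) * d₁) + (1ℤ + M) * (+ 2 + M) * d₂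
      ≡⟨ cong₂ (λ s t → (1ℤ + M) * (+ 2 + M) * c₀ + + 2 * (+ 2 + M) * s + t) down₁ down₂ ⟩
    (1ℤ + M) * (+ 2 + M) * c₀ + + 2 * (+ 2 + M) * (K * c₀) + K * (K - 1ℤ) * c₀
      ≡⟨ ring₂ K M c₀ ⟩
    N₁ * N₂ * c₀ ∎
    where
    ring₁ : ∀ M c d e → (1ℤ + M) * (+ 2 + M) * (c + d + (d + e)) ≡
      (1ℤ + M) * (+ 2 + M) * c + + 2 * (+ 2 + M) * ((1ℤ + M) * d) + (1ℤ + M) * (+ 2 + M) * e
    ring₁ = solve-∀
    ring₂ : ∀ K M c → (1ℤ + M) * (+ 2 + M) * c + + 2 * (+ 2 + M) * (K * c) + K * (K - 1ℤ) * c ≡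
      (1ℤ + (K + M)) * (+ 2 + (K + M)) * c
    ring₂ = solve-∀

  middle : (1ℤ + K) * (1ℤ + M) * b₁ ≡ N₁ * N₂ * c₀
  middle = begin
    (1ℤ + K) * (1ℤ + M) * b₁
      ≡⟨ cong ((1ℤ + K) * (1ℤ + M) *_) (trans (pascal-suc (suc n) K) (cong₂ _+_ (pascal-suc n K) (pascal n K))) ⟩
    (1ℤ + K) * (1ℤ + M) * (c₁ + c₀ + (c₀ + d₁))
      ≡⟨ ring₁ K M c₀ c₁ d₁ ⟩
    + 2 * ((1ℤ + K) * (1ℤ + M)) * c₀ + (1ℤ + M) * ((1ℤ + K) * c₁) + (1ℤ + K) * ((1ℤ + M) * d₁)
      ≡⟨ cong₂ (λ s t → + 2 * ((1ℤ + K) * (1ℤ + M)) * c₀ + (1ℤ + M) * s + (1ℤ + K) * t) up₁ down₁ ⟩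
    + 2 * ((1ℤ + K) * (1ℤ + M)) * c₀ + (1ℤ + M) * (M * c₀) + (1ℤ + K) * (K * c₀)
      ≡⟨ ring₂ K M c₀ ⟩
    N₁ * N₂ * c₀ ∎
    where
    ring₁ : ∀ K M c d e → (1ℤ + K) * (1ℤ + M) * (d + c + (c + e)) ≡
      + 2 * ((1ℤ + K) * (1ℤ + M)) * c + (1ℤ + M) * ((1ℤ + K) * d) + (1ℤ + K) * ((1ℤ + M) * e)
    ring₁ = solve-∀
    ring₂ : ∀ K M c → + 2 * ((1ℤ + K) * (1ℤ + M)) * c + (1ℤ + M) * (M * c) + (1ℤ + K) * (K * c) ≡
      (1ℤ + (K + M)) * (+ 2 + (K + M)) * c
    ring₂ = solve-∀

  upper : (1ℤ + K) * (+ 2 + K) * b₂ ≡ N₁ * N₂ * c₀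
  upper = begin
    (1ℤ + K) * (+ 2 + K) * b₂
      ≡⟨ cong ((1ℤ + K) * (+ 2 + K) *_) (trans (pascal-suc (suc n) (sucℤ K)) (cong₂ _+_ (pascal-suc n (sucℤ K)) (pascal-suc n K))) ⟩
    (1ℤ + K) * (+ 2 + K) * (c₂ + c₁ + (c₁ + c₀))
      ≡⟨ ring₁ K c₀ c₁ c₂ ⟩
    (1ℤ + K) * (+ 2 + K) * c₀ + + 2 * (+ 2 + K) * ((1ℤ + K) * c₁) + (1ℤ + K) * (+ 2 + K) * c₂
      ≡⟨ cong₂ (λ s t → (1ℤ + K) * (+ 2 + K) * c₀ + + 2 * (+ 2 + K) * s + t) up₁ up₂ ⟩
    (1ℤ + K) * (+ 2 + K) * c₀ + + 2 * (+ 2 + K) * (M * c₀) + M * (M - 1ℤ) * c₀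
      ≡⟨ ring₂ K M c₀ ⟩
    N₁ * N₂ * c₀ ∎
    where
    ring₁ : ∀ K c d e → (1ℤ + K) * (+ 2 + K) * (e + d + (d + c)) ≡
      (1ℤ + K) * (+ 2 + K) * c + + 2 * (+ 2 + K) * ((1ℤ + K) * d) + (1ℤ + K) * (+ 2 + K) * e
    ring₁ = solve-∀
    ring₂ : ∀ K M c → (1ℤ + K) * (+ 2 + K) * c + + 2 * (+ 2 + K) * (M * c) + M * (M - 1ℤ) * c ≡
      (1ℤ + (K + M)) * (+ 2 + (K + M)) * c
    ring₂ = solve-∀

  doubleC2 : + 2 * + (suc (suc n) C 2) ≡ N₁ * N₂
  doubleC2 = trans (binom-absorb (suc (suc n)) 1ℤ) (cong (λ t → N₁ * + t) (nC1≡n (suc (suc n))))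

  scaled : D * nonCrossing n k ≡ + 2 * (N₁ * N₁ * N₂) * (c₀ * (c₀ * c₀))
  -- In each of the terms `D` contains the denominators of the neighbours that occur; once these are
  -- paired off, the ratios apply and a polynomial identity in K, M and c₀ remains.
  scaled = trans (scaled-terms K M c₀ c₁ c₂ d₁ d₂) (trans
    (cong₂ _-_ (cong₂ _+_ (cong₂ _+_ (cong
      (λ t → D * (c₀ * (c₀ * c₀)) - + 2 * c₀ * ((1ℤ + M) * (+ 2 + M) * ((1ℤ + K) * (+ 2 + K))) * t)
      (cong₂ _*_ up₁ down₁))
      (cong ((1ℤ + M) * (+ 2 + K) *_) (cong₂ _*_ (cong₂ _*_ up₁ up₁) down₂)))
      (cong ((1ℤ + K) * (+ 2 + M) *_) (cong₂ _*_ (cong₂ _*_ down₁ down₁) up₂)))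
      (cong (c₀ * ((1ℤ + M) * (1ℤ + K)) *_) (cong₂ _*_ up₂ down₂)))
    (scaled-value K M c₀))
    where
    scaled-terms : ∀ K M c₀ c₁ c₂ d₁ d₂ →
      (1ℤ + M) * (1ℤ + M) * (+ 2 + M) * ((1ℤ + K) * (1ℤ + K) * (+ 2 + K)) *
        (c₀ * (c₀ * c₀) - c₀ * (c₁ * d₁) - c₀ * (c₁ * d₁) + c₁ * (c₁ * d₂) + d₁ * (d₁ * c₂) - c₀ * (c₂ * d₂))
      ≡ (1ℤ + M) * (1ℤ + M) * (+ 2 + M) * ((1ℤ + K) * (1ℤ + K) * (+ 2 + K)) * (c₀ * (c₀ * c₀))
        - + 2 * c₀ * ((1ℤ + M) * (+ 2 + M) * ((1ℤ + K) * (+ 2 + K))) * (((1ℤ + K) * c₁) * ((1ℤ + M) * d₁))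
        + (1ℤ + M) * (+ 2 + K) * (((1ℤ + K) * c₁) * ((1ℤ + K) * c₁) * ((1ℤ + M) * (+ 2 + M) * d₂))
        + (1ℤ + K) * (+ 2 + M) * (((1ℤ + M) * d₁) * ((1ℤ + M) * d₁) * ((1ℤ + K) * (+ 2 + K) * c₂))
        - c₀ * ((1ℤ + M) * (1ℤ + K)) * (((1ℤ + K) * (+ 2 + K) * c₂) * ((1ℤ + M) * (+ 2 + M) * d₂))
    scaled-terms = solve-∀
    scaled-value : ∀ K M c₀ →
        (1ℤ + M) * (1ℤ + M) * (+ 2 + M) * ((1ℤ + K) * (1ℤ + K) * (+ 2 + K)) * (c₀ * (c₀ * c₀))
        - + 2 * c₀ * ((1ℤ + M) * (+ 2 + M) * ((1ℤ + K) * (+ 2 + K))) * ((M * c₀) * (K * c₀))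
        + (1ℤ + M) * (+ 2 + K) * ((M * c₀) * (M * c₀) * (K * (K - 1ℤ) * c₀))
        + (1ℤ + K) * (+ 2 + M) * ((K * c₀) * (K * c₀) * (M * (M - 1ℤ) * c₀))
        - c₀ * ((1ℤ + M) * (1ℤ + K)) * ((M * (M - 1ℤ) * c₀) * (K * (K - 1ℤ) * c₀))
      ≡ + 2 * ((1ℤ + (K + M)) * (1ℤ + (K + M)) * (+ 2 + (K + M))) * (c₀ * (c₀ * c₀))
    scaled-value = solve-∀

  distribute : ∀ K M b₀ b₁ b₂ →
    + 2 * ((1ℤ + M) * (1ℤ + M) * (+ 2 + M) * ((1ℤ + K) * (1ℤ + K) * (+ 2 + K))) * (b₀ * b₁ * b₂)
    ≡ + 2 * (((1ℤ + M) * (+ 2 + M) * b₀) * ((1ℤ + K) * (1ℤ + M) * b₁) * ((1ℤ + K) * (+ 2 + K) * b₂))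
  distribute = solve-∀
  regroup : ∀ K M c → let N₁ = 1ℤ + (K + M); N₂ = + 2 + (K + M) in
    + 2 * ((N₁ * N₂ * c) * (N₁ * N₂ * c) * (N₁ * N₂ * c)) ≡ N₂ * (N₁ * N₂) * (+ 2 * (N₁ * N₁ * N₂) * (c * (c * c)))
  regroup = solve-∀
  rotate : ∀ a b d e → a * (+ 2 * b) * (d * e) ≡ + 2 * d * (a * b * e)
  rotate = solve-∀

-- From the six free walk numbers to the Baxter number.

freeWalks-sum : ∀ n a b c → a + b + c ≡ 0ℤ → freeWalks n a b c ≡
  sumBelow (suc n) (λ k → binom n (0ℤ + + k) * (binom n (b + + k) * binom n ((a + b) + + k)))
freeWalks-sum n a b c s = trans (freeWalks-walkers (suc n) n (ℕ.n<1+n n) a b c s)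
  (sumBelow-cong (suc n) (λ k _ → cong₂ (λ s t → binom n (+ k) * (binom n s * binom n t))
    (+-comm (+ k) b) (+-comm (+ k) (a + b))))

-- The G₂-symmetry moves the endpoints to representatives for which the walkers' offsets (0 , b , a
-- + b) are those in a term of the determinant. Only (0 , 0 , -3) and (0 , 0 , 3) still differ, by a
-- shift of k by one, whose boundary terms are zero.
rowWalks-nonCrossing : ∀ n → rowWalks n 0 0 ≡ sumBelow (suc n) (nonCrossing n)
rowWalks-nonCrossing n = begin
  rowWalks n 0 0
    ≡⟨ rowWalks-origin n ⟩
  A (+ 0) (+ 0) (+ 0) - A (- + 2) (+ 1) (+ 1) - A (+ 1) (- + 2) (+ 1)
    + A (- + 3) (+ 0) (+ 3) + A (+ 0) (- + 3) (+ 3) - A (- + 2) (- + 2) (+ 4)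
    ≡⟨ cong₂ _-_ (cong₂ _+_ (cong₂ _+_ (cong₂ _-_ (cong₂ _-_
         (freeWalks-sum n (+ 0) (+ 0) (+ 0) refl)
         (freeWalks-sum n (- + 2) (+ 1) (+ 1) refl))
         (trans (freeWalks-swap₁₂ n (+ 1) (- + 2) (+ 1)) (freeWalks-sum n (- + 2) (+ 1) (+ 1) refl)))
         (trans (freeWalks-sum n (- + 3) (+ 0) (+ 3) refl) (sym t₄-shift)))
         (trans (trans (freeWalks-swap₁₂ n (+ 0) (- + 3) (+ 3)) (freeWalks-negate n (- + 3) (+ 0) (+ 3)))
           (trans (freeWalks-sum n (+ 3) (+ 0) (- + 3) refl) (sumBelow-shift (suc n) t₅ refl t₅-end))))
         (trans (freeWalks-negate n (- + 2) (- + 2) (+ 4))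
           (trans (trans (freeWalks-swap₂₃ n (+ 2) (+ 2) (- + 4)) (freeWalks-swap₁₂ n (+ 2) (- + 4) (+ 2)))
             (freeWalks-sum n (- + 4) (+ 2) (+ 2) refl))) ⟩
  Σ t₁ - Σ t₂ - Σ t₂ + Σ t₄ + Σ t₅ - Σ t₆
    ≡⟨ cong (λ s → s - Σ t₂ + Σ t₄ + Σ t₅ - Σ t₆) (sumBelow-- (suc n) t₁ t₂) ⟨
  Σ (λ k → t₁ k - t₂ k) - Σ t₂ + Σ t₄ + Σ t₅ - Σ t₆
    ≡⟨ cong (λ s → s + Σ t₄ + Σ t₅ - Σ t₆) (sumBelow-- (suc n) (λ k → t₁ k - t₂ k) t₂) ⟨
  Σ (λ k → t₁ k - t₂ k - t₂ k) + Σ t₄ + Σ t₅ - Σ t₆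
    ≡⟨ cong (λ s → s + Σ t₅ - Σ t₆) (sumBelow-+ (suc n) (λ k → t₁ k - t₂ k - t₂ k) t₄) ⟨
  Σ (λ k → t₁ k - t₂ k - t₂ k + t₄ k) + Σ t₅ - Σ t₆
    ≡⟨ cong (_- Σ t₆) (sumBelow-+ (suc n) (λ k → t₁ k - t₂ k - t₂ k + t₄ k) t₅) ⟨
  Σ (λ k → t₁ k - t₂ k - t₂ k + t₄ k + t₅ k) - Σ t₆
    ≡⟨ sumBelow-- (suc n) (λ k → t₁ k - t₂ k - t₂ k + t₄ k + t₅ k) t₆ ⟨
  Σ (nonCrossing n) ∎
  where
  A = freeWalks n
  Σ = sumBelow (suc n)
  c : ℕ → ℤ → ℤ
  c k d = binom n (d + + k)
  t₁ t₂ t₄ t₄′ t₅ t₆ : ℕ → ℤ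
  t₁ k = c k (+ 0) * (c k (+ 0) * c k (+ 0))
  t₂ k = c k (+ 0) * (c k (+ 1) * c k (- + 1))
  t₄ k = c k (+ 1) * (c k (+ 1) * c k (- + 2))
  t₄′ k = c k (+ 0) * (c k (+ 0) * c k (- + 3))
  t₅ k = c k (- + 1) * (c k (- + 1) * c k (+ 2))
  t₆ k = c k (+ 0) * (c k (+ 2) * c k (- + 2))
  t₄′-end : t₄′ (suc n) ≡ 0ℤ
  t₄′-end = cong (_* (c (suc n) (+ 0) * c (suc n) (- + 3))) (binom-above (ℕ.n<1+n n))
  t₄-shift : Σ t₄ ≡ Σ t₄′
  t₄-shift = trans
    (sumBelow-cong (suc n) λ k _ → cong (λ i → c k (+ 1) * (c k (+ 1) * binom n i)) (+-assoc (- + 3) 1ℤ (+ k)))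
    (sumBelow-shift (suc n) t₄′ refl t₄′-end)
  t₅-end : t₅ (suc n) ≡ 0ℤ
  t₅-end = trans
    (cong (λ t → c (suc n) (- + 1) * (c (suc n) (- + 1) * t)) (binom-above (ℕ.m≤n+m (suc n) 2)))
    (trans (cong (c (suc n) (- + 1) *_) (*-zeroʳ (c (suc n) (- + 1)))) (*-zeroʳ (c (suc n) (- + 1))))

sum-upTo : ∀ N (f : ℕ → ℕ) → + sum (map f (upTo N)) ≡ sumBelow N (λ k → + f k)
sum-upTo N f = trans (cong (λ xs → + sum xs) (map-upTo f N)) (sum-applyUpTo N f)
  where
  sum-applyUpTo : ∀ N (f : ℕ → ℕ) → + sum (applyUpTo f N) ≡ sumBelow N (λ k → + f k)
  sum-applyUpTo zero    f = refl
  sum-applyUpTo (suc N) f = cong (λ t → + f 0 + t) (sum-applyUpTo N (f ∘ suc))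

-- This also yields the sign of z: a negative z would make a natural number equal to a negative one.
exact-quotient : ∀ x w .{{_ : ℕ.NonZero w}} z → + x ≡ + w * z → + (x ℕ./ w) ≡ z
exact-quotient x w (+ q) e = cong +_ (begin
  x ℕ./ w           ≡⟨ cong (ℕ._/ w) (trans (+-injective (trans e (sym (pos-* w q)))) (ℕ.*-comm w q)) ⟩
  (q ℕ.* w) ℕ./ w   ≡⟨ m*n/n≡m q w ⟩
  q                 ∎)
exact-quotient x (suc w) -[1+ q ] ()

Baxter-nonCrossing : ∀ n → + Baxter (suc n) ≡ sumBelow (suc n) (nonCrossing n)
Baxter-nonCrossing n = trans (sum-upTo (suc n) _)
  -- From k < n + 1 comes the decomposition n = k + m in which the product formula is stated.
  (sumBelow-cong (suc n) λ k k<1+n → quotient k (ℕ.m≤n⇒∃[o]m+o≡n (ℕ.s≤s⁻¹ k<1+n)))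
  where
  M = suc (suc n)
  instance
    C1≢0 : ℕ.NonZero (M C 1)
    C1≢0 = subst ℕ.NonZero (sym (nC1≡n M)) _
    C2≢0 : ℕ.NonZero (M C 2)
    C2≢0 = ℕ.>-nonZero (C2-pos n)
    C1*C2≢0 : ℕ.NonZero ((M C 1) ℕ.* (M C 2))
    C1*C2≢0 = ℕ.m*n≢0 (M C 1) (M C 2)
  quotient : ∀ k → (∃ λ m → k ℕ.+ m ≡ n) →
    + (((M C k) ℕ.* (M C suc k) ℕ.* (M C suc (suc k))) ℕ./ ((M C 1) ℕ.* (M C 2))) ≡ nonCrossing n k
  quotient k (m , refl) = exact-quotient ((M C k) ℕ.* (M C suc k) ℕ.* (M C suc (suc k))) ((M C 1) ℕ.* (M C 2))
    (nonCrossing n k) (nonCrossing-product k m)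

rowWalks-Baxter : ∀ n → rowWalks n 0 0 ≡ + Baxter (suc n)
rowWalks-Baxter n = trans (rowWalks-nonCrossing n) (sym (Baxter-nonCrossing n))

-- Enumeration of tableaux

module _ {A : Set} where

  hasCount-⇔ : {P Q : A → Set} {N : ℕ} → (∀ x → P x ⇔ Q x) → HasCount P N → HasCount Q N
  hasCount-⇔ P⇔Q (xs , len , uniq , mem) = xs , len , uniq , λ x →
    mk⇔ (to (P⇔Q x) ∘ to (mem x)) (from (mem x) ∘ from (P⇔Q x))

  hasCount-∅ : {P : A → Set} → (∀ x → P x → ⊥) → HasCount P 0
  hasCount-∅ empty = [] , refl , [] , λ x → mk⇔ (λ ()) (λ px → ⊥-elim (empty x px))

  hasCount-singleton : (a : A) → HasCount (_≡ a) 1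
  hasCount-singleton a = a ∷ [] , refl , [] ∷ [] , λ x → mk⇔ (λ { (here e) → e ; (there ()) }) here

  hasCount-⊎ : {P Q : A → Set} {M N : ℕ} → (∀ x → P x → Q x → ⊥) →
    HasCount P M → HasCount Q N → HasCount (λ x → P x ⊎ Q x) (M ℕ.+ N)
  hasCount-⊎ {P} {Q} disjoint (xs , lenˣ , uniqˣ , memˣ) (ys , lenʸ , uniqʸ , memʸ) =
    xs ++ ys
    , trans (length-++ xs) (cong₂ ℕ._+_ lenˣ lenʸ)
    , Unique.++⁺ uniqˣ uniqʸ (λ (x∈xs , x∈ys) → disjoint _ (to (memˣ _) x∈xs) (to (memʸ _) x∈ys))
    , λ x → mk⇔ (split x ∘ ∈-++⁻ xs) λ
        { (inj₁ p) → ∈-++⁺ˡ (from (memˣ x) p)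
        ; (inj₂ q) → ∈-++⁺ʳ xs (from (memʸ x) q) }
    where
    split : ∀ x → x ∈ xs ⊎ x ∈ ys → P x ⊎ Q x
    split x (inj₁ i) = inj₁ (to (memˣ x) i)
    split x (inj₂ i) = inj₂ (to (memʸ x) i)

hasCount-map : {A B : Set} {P : A → Set} {N : ℕ} (f : A → B) → (∀ {x y} → f x ≡ f y → x ≡ y) →
  HasCount P N → HasCount (λ b → ∃[ a ] (b ≡ f a × P a)) N
hasCount-map {P = P} f f-inj (xs , len , uniq , mem) =
  map f xs , trans (length-map f xs) len , Unique.map⁺ f-inj uniq , λ b → mk⇔
    (λ b∈ → let a , a∈xs , b≡fa = ∈-map⁻ f b∈ in a , b≡fa , to (mem a) a∈xs)
    λ { (a , refl , pa) → ∈-map⁺ f (from (mem a) pa) }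

-- Tails of tableaux and the admissible double steps.

EndsInRow : List Shape → Set
EndsInRow xs = ∃[ m ] ∃[ ys ] xs ≡ ys ∷ʳ (m , 0)

-- What remains of a tableau after the diagram `p`. The end condition includes `p`, which is itself
-- the last diagram when n = 0.
RowTail : ℕ → Shape → List Shape → Set
RowTail n p xs = length xs ≡ 2 ℕ.* n × HesFrom p xs × All IsDiagram xs × EndsInRow (p ∷ xs)

-- The cases a - b = 0, 1 and at least 2. Adding to the second row or removing from the first
-- requires a difference of at least 1, moving a box from the first row to the second at least 2.
data Gap : ℕ → ℕ → Set where
  closed : ∀ {b} → Gap b b
  narrow : ∀ {b} → Gap (suc b) b
  wide   : ∀ {a b} → b ℕ.≤ a → Gap (suc (suc a)) b

gap : ∀ {a b} → b ℕ.≤ a → Gap a b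
gap {zero}        ℕ.z≤n = closed
gap {suc zero}    ℕ.z≤n = narrow
gap {suc (suc a)} ℕ.z≤n = wide ℕ.z≤n
gap (ℕ.s≤s b≤a) with gap b≤a
... | closed   = closed
... | narrow   = narrow
... | wide b≤a = wide (ℕ.s≤s b≤a)

Gap⇒≤ : ∀ {a b} → Gap a b → b ℕ.≤ a
Gap⇒≤ closed     = ℕ.≤-refl
Gap⇒≤ narrow     = ℕ.n≤1+n _
Gap⇒≤ (wide b≤a) = ℕ.m≤n⇒m≤1+n (ℕ.m≤n⇒m≤1+n b≤a)

lowerSteps : ℕ → ℕ → List (Shape × Shape) → List (Shape × Shape)
lowerSteps a zero    cs = cs
lowerSteps a (suc b) cs = ((a , b) , (a , b)) ∷ ((suc a , suc b) , (suc a , b)) ∷ cs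

gapSteps : ∀ {a b} → Gap a b → List (Shape × Shape)
gapSteps closed = []
gapSteps (narrow {b}) =
    ((suc b , b) , (suc b , suc b)) ∷ ((b , b) , (b , b)) ∷ ((suc b , suc b) , (suc b , b)) ∷ []
gapSteps (wide {a} {b} _) =
    ((2+a , b) , (2+a , suc b)) ∷ ((suc a , b) , (suc a , b)) ∷ ((2+a , suc b) , (2+a , b))
  ∷ ((2+a , suc b) , (suc a , suc b)) ∷ []
  where 2+a = suc (suc a)

-- Of the eight conceivable double steps two are always possible, the two in `lowerSteps` require b
-- > 0, and the four in `gapSteps` depend on a - b. Recording the intermediate diagram keeps the two
-- loops apart.
steps : ∀ {a b} → Gap a b → List (Shape × Shape)
steps {a} {b} g = ((a , b) , (suc a , b)) ∷ ((suc a , b) , (a , b)) ∷ lowerSteps a b (gapSteps g)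

ValidStep : Shape → Shape × Shape → Set
ValidStep p (q , r) = HStep p q r × IsDiagram q × IsDiagram r

steps-unique : ∀ {a b} (g : Gap a b) → Unique (steps g)
steps-unique (closed {zero})  = ((λ ()) ∷ []) ∷ [] ∷ []
steps-unique (closed {suc b}) = ((λ ()) ∷ (λ ()) ∷ (λ ()) ∷ []) ∷ ((λ ()) ∷ (λ ()) ∷ []) ∷ ((λ ()) ∷ []) ∷ [] ∷ []
steps-unique (narrow {zero})  =
  ((λ ()) ∷ (λ ()) ∷ (λ ()) ∷ (λ ()) ∷ []) ∷ ((λ ()) ∷ (λ ()) ∷ (λ ()) ∷ []) ∷
  ((λ ()) ∷ (λ ()) ∷ []) ∷ ((λ ()) ∷ []) ∷ [] ∷ []
steps-unique (narrow {suc b}) =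
  ((λ ()) ∷ (λ ()) ∷ (λ ()) ∷ (λ ()) ∷ (λ ()) ∷ (λ ()) ∷ []) ∷ ((λ ()) ∷ (λ ()) ∷ (λ ()) ∷ (λ ()) ∷ (λ ()) ∷ []) ∷
  ((λ ()) ∷ (λ ()) ∷ (λ ()) ∷ (λ ()) ∷ []) ∷ ((λ ()) ∷ (λ ()) ∷ (λ ()) ∷ []) ∷
  ((λ ()) ∷ (λ ()) ∷ []) ∷ ((λ ()) ∷ []) ∷ [] ∷ []
steps-unique (wide {b = zero} _)  =
  ((λ ()) ∷ (λ ()) ∷ (λ ()) ∷ (λ ()) ∷ (λ ()) ∷ []) ∷ ((λ ()) ∷ (λ ()) ∷ (λ ()) ∷ (λ ()) ∷ []) ∷
  ((λ ()) ∷ (λ ()) ∷ (λ ()) ∷ []) ∷ ((λ ()) ∷ (λ ()) ∷ []) ∷ ((λ ()) ∷ []) ∷ [] ∷ []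
steps-unique (wide {b = suc b} _) =
  ((λ ()) ∷ (λ ()) ∷ (λ ()) ∷ (λ ()) ∷ (λ ()) ∷ (λ ()) ∷ (λ ()) ∷ []) ∷
  ((λ ()) ∷ (λ ()) ∷ (λ ()) ∷ (λ ()) ∷ (λ ()) ∷ (λ ()) ∷ []) ∷ ((λ ()) ∷ (λ ()) ∷ (λ ()) ∷ (λ ()) ∷ (λ ()) ∷ []) ∷
  ((λ ()) ∷ (λ ()) ∷ (λ ()) ∷ (λ ()) ∷ []) ∷ ((λ ()) ∷ (λ ()) ∷ (λ ()) ∷ []) ∷
  ((λ ()) ∷ (λ ()) ∷ []) ∷ ((λ ()) ∷ []) ∷ [] ∷ []

steps-sound : ∀ {a b} (g : Gap a b) → All (ValidStep (a , b)) (steps g)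
steps-sound {a} {b} g =
    (inj₁ (refl , inj₁ (refl , refl)) , b≤a , ℕ.m≤n⇒m≤1+n b≤a)
  ∷ (inj₂ (inj₂ (inj₁ (refl , refl) , inj₁ (refl , refl))) , ℕ.m≤n⇒m≤1+n b≤a , b≤a)
  ∷ lower b b≤a (inner g)
  where
  b≤a = Gap⇒≤ g
  lower : ∀ b {cs} → b ℕ.≤ a → All (ValidStep (a , b)) cs → All (ValidStep (a , b)) (lowerSteps a b cs)
  lower zero    b≤a vs = vs
  lower (suc b) b<a vs =
      (inj₂ (inj₁ (inj₂ (refl , refl) , refl)) , ℕ.<⇒≤ b<a , ℕ.<⇒≤ b<a)
    ∷ (inj₂ (inj₂ (inj₁ (refl , refl) , inj₂ (refl , refl))) , ℕ.m≤n⇒m≤1+n b<a , ℕ.m≤n⇒m≤1+n (ℕ.<⇒≤ b<a))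
    ∷ vs
  inner : ∀ {a b} (g : Gap a b) → All (ValidStep (a , b)) (gapSteps g)
  inner closed = []
  inner narrow =
      (inj₁ (refl , inj₂ (refl , refl)) , ℕ.n≤1+n _ , ℕ.≤-refl)
    ∷ (inj₂ (inj₁ (inj₁ (refl , refl) , refl)) , ℕ.≤-refl , ℕ.≤-refl)
    ∷ (inj₂ (inj₂ (inj₂ (refl , refl) , inj₂ (refl , refl))) , ℕ.≤-refl , ℕ.n≤1+n _)
    ∷ []
  inner (wide b≤a) =
      (inj₁ (refl , inj₂ (refl , refl)) , b≤2+a , ℕ.m≤n⇒m≤1+n (ℕ.s≤s b≤a))
    ∷ (inj₂ (inj₁ (inj₁ (refl , refl) , refl)) , ℕ.m≤n⇒m≤1+n b≤a , ℕ.m≤n⇒m≤1+n b≤a)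
    ∷ (inj₂ (inj₂ (inj₂ (refl , refl) , inj₂ (refl , refl))) , ℕ.m≤n⇒m≤1+n (ℕ.s≤s b≤a) , b≤2+a)
    ∷ (inj₂ (inj₂ (inj₂ (refl , refl) , inj₁ (refl , refl))) , ℕ.m≤n⇒m≤1+n (ℕ.s≤s b≤a) , ℕ.s≤s b≤a)
    ∷ []
    where b≤2+a = ℕ.m≤n⇒m≤1+n (ℕ.m≤n⇒m≤1+n b≤a)

∈-lowerSteps : ∀ {a} b {c cs} → c ∈ cs → c ∈ lowerSteps a b cs
∈-lowerSteps zero    i = i
∈-lowerSteps (suc b) i = there (there i)

steps-complete : ∀ {a b} (g : Gap a b) {q r} → ValidStep (a , b) (q , r) → (q , r) ∈ steps g
steps-complete g (inj₁ (refl , inj₁ (refl , refl)) , _) = here refl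
steps-complete g (inj₂ (inj₂ (inj₁ (refl , refl) , inj₁ (refl , refl))) , _) = there (here refl)
steps-complete g (inj₂ (inj₁ (inj₂ (refl , refl) , refl)) , _) = there (there (here refl))
steps-complete g (inj₂ (inj₂ (inj₁ (refl , refl) , inj₂ (refl , refl))) , _) = there (there (there (here refl)))
steps-complete {b = b} g (inj₁ (refl , inj₂ (refl , refl)) , _ , dr) = there (there (∈-lowerSteps b (inner g dr)))
  where
  inner : ∀ {a b} (g : Gap a b) → suc b ℕ.≤ a → ((a , b) , (a , suc b)) ∈ gapSteps g
  inner closed   b<b = ⊥-elim (ℕ.<-irrefl refl b<b)
  inner narrow   _   = here refl
  inner (wide _) _   = here refl
steps-complete {b = b} g (inj₂ (inj₁ (inj₁ (refl , refl) , refl)) , _ , dr) = there (there (∈-lowerSteps b (inner g dr)))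
  where
  inner : ∀ {a b} (g : Gap (suc a) b) → b ℕ.≤ a → ((a , b) , (a , b)) ∈ gapSteps g
  inner closed   b<b = ⊥-elim (ℕ.<-irrefl refl b<b)
  inner narrow   _   = there (here refl)
  inner (wide _) _   = there (here refl)
steps-complete {b = b} g (inj₂ (inj₂ (inj₂ (refl , refl) , inj₂ (refl , refl))) , dq , _) = there (there (∈-lowerSteps b (inner g dq)))
  where
  inner : ∀ {a b} (g : Gap a b) → suc b ℕ.≤ a → ((a , suc b) , (a , b)) ∈ gapSteps g
  inner closed   b<b = ⊥-elim (ℕ.<-irrefl refl b<b)
  inner narrow   _   = there (there (here refl))
  inner (wide _) _   = there (there (here refl))
steps-complete {b = b} g (inj₂ (inj₂ (inj₂ (refl , refl) , inj₁ (refl , refl))) , _ , dr) = there (there (∈-lowerSteps b (inner g dr)))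
  where
  inner : ∀ {a b} (g : Gap (suc a) b) → suc b ℕ.≤ a → ((suc a , suc b) , (a , suc b)) ∈ gapSteps g
  inner closed   b<a = ⊥-elim (ℕ.<-irrefl refl (ℕ.<-trans (ℕ.n<1+n _) b<a))
  inner narrow   b<b = ⊥-elim (ℕ.<-irrefl refl b<b)
  inner (wide _) _   = there (there (there (here refl)))

-- Equality of the recursions for tableaux and for signed walks.

rowValue : ℕ → Shape × Shape → ℤ
rowValue n (_ , (a , b)) = rowWalks n a b

sumℤ : List ℤ → ℤ
sumℤ = foldr _+_ 0ℤ

-- Taking an arbitrary list of first double steps allows the counts to be added up by induction on
-- that list.
Continuation : ℕ → List (Shape × Shape) → List Shape → Set
Continuation n cs ys = ∃[ q ] ∃[ r ] ∃[ xs ] ((q , r) ∈ cs × ys ≡ q ∷ r ∷ xs × RowTail n r xs)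

count-continuations : ∀ n cs → Unique cs →
  All (λ c → ∃[ N ] (HasCount (RowTail n (proj₂ c)) N × + N ≡ rowValue n c)) cs →
  ∃[ N ] (HasCount (Continuation n cs) N × + N ≡ sumℤ (map (rowValue n) cs))
count-continuations n [] [] [] = 0 , hasCount-∅ (λ { _ (_ , _ , _ , () , _) }) , refl
count-continuations n ((q , r) ∷ cs) (new ∷ uniq) ((M , countM , M≡) ∷ counts)
  with count-continuations n cs uniq counts
... | N , countN , N≡ =
  M ℕ.+ N
  , hasCount-⇔ regroup (hasCount-⊎ disjoint
      (hasCount-map (λ xs → q ∷ r ∷ xs) (∷-injectiveʳ ∘ ∷-injectiveʳ) countM) countN)
  , cong₂ _+_ M≡ N≡
  where
  Head : List Shape → Set
  Head ys = ∃[ xs ] (ys ≡ q ∷ r ∷ xs × RowTail n r xs)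
  disjoint : ∀ ys → Head ys → Continuation n cs ys → ⊥
  disjoint _ (_ , refl , _) (_ , _ , _ , c∈cs , refl , _) = All.lookup new c∈cs refl
  regroup : ∀ ys → (Head ys ⊎ Continuation n cs ys) ⇔ Continuation n ((q , r) ∷ cs) ys
  regroup ys = mk⇔
    (λ { (inj₁ (xs , e , t)) → q , r , xs , here refl , e , t
       ; (inj₂ (q′ , r′ , xs , i , e , t)) → q′ , r′ , xs , there i , e , t })
    (λ { (_ , _ , xs , here refl , e , t) → inj₁ (xs , e , t)
       ; (q′ , r′ , xs , there i , e , t) → inj₂ (q′ , r′ , xs , i , e , t) })

EndsInRow-step : ∀ p q {r xs} → EndsInRow (r ∷ xs) ⇔ EndsInRow (p ∷ q ∷ r ∷ xs)
EndsInRow-step p q {r} {xs} = mk⇔ (λ { (m , ys , e) → m , p ∷ q ∷ ys , cong (λ zs → p ∷ q ∷ zs) e }) drop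
  where
  drop : EndsInRow (p ∷ q ∷ r ∷ xs) → EndsInRow (r ∷ xs)
  drop (m , []     , ())
  drop (m , _ ∷ [] , ())
  drop (m , _ ∷ _ ∷ ys , e) = m , ys , ∷-injectiveʳ (∷-injectiveʳ e)

RowTail-suc : ∀ n {a b} (g : Gap a b) ys → Continuation n (steps g) ys ⇔ RowTail (suc n) (a , b) ys
RowTail-suc n {a} {b} g ys = mk⇔ extend split
  where
  double-suc : ∀ n → 2 ℕ.* suc n ≡ suc (suc (2 ℕ.* n))
  double-suc n = cong suc (ℕ.+-suc n (n ℕ.+ 0))
  extend : ∀ {ys} → Continuation n (steps g) ys → RowTail (suc n) (a , b) ys
  extend (q , r , xs , c∈ , refl , len , hes , diagrams , ends) =
    let h , dq , dr = All.lookup (steps-sound g) c∈ in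
    trans (cong (suc ∘ suc) len) (sym (double-suc n)) , (h , hes) , dq ∷ dr ∷ diagrams
    , to (EndsInRow-step (a , b) q) ends
  split : ∀ {ys} → RowTail (suc n) (a , b) ys → Continuation n (steps g) ys
  split {[]} (() , _)
  split {_ ∷ []} (_ , () , _)
  split {q ∷ r ∷ xs} (len , (h , hes) , dq ∷ dr ∷ diagrams , ends) =
    q , r , xs , steps-complete g (h , dq , dr) , refl
    , ℕ.suc-injective (ℕ.suc-injective (trans len (double-suc n))) , hes , diagrams
    , from (EndsInRow-step (a , b) q) ends

rowWalks-upper : ∀ n a b → rayCount n (+ suc (suc a)) (+ suc (suc b)) -[1+ suc (suc (suc a ℕ.+ b)) ] ≡ rowWalks n a (suc b)
rowWalks-upper n a b = cong (λ t → rayCount n (+ suc (suc a)) (+ suc (suc b)) -[1+ suc (suc t) ]) (sym (ℕ.+-suc a b))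

-- The two neighbours with y lowered by one correspond to the steps that shorten the second row. For
-- b = 0 these steps do not exist, and the neighbours lie on the wall y = 0, where `rayCount`
-- vanishes.
lowerSteps-sum : ∀ n a b cs →
  rayCount n (+ suc (suc a)) (+ b) -[1+ suc (a ℕ.+ b) ]
  + (rayCount n (+ suc (suc (suc a))) (+ b) -[1+ suc (suc (a ℕ.+ b)) ] + sumℤ (map (rowValue n) cs))
  ≡ sumℤ (map (rowValue n) (lowerSteps a b cs))
lowerSteps-sum n a zero cs rewrite ℕ.+-identityʳ a = begin
  rayCount n (+ suc (suc a)) 0ℤ (- + suc (suc a)) + (rayCount n (+ suc (suc (suc a))) 0ℤ (- + suc (suc (suc a))) + s)
    ≡⟨ cong₂ (λ t u → t + (u + s)) (rayCount-bottom n (+ suc (suc a))) (rayCount-bottom n (+ suc (suc (suc a)))) ⟩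
  0ℤ + (0ℤ + s)
    ≡⟨ trans (+-identityˡ _) (+-identityˡ s) ⟩
  s ∎
  where s = sumℤ (map (rowValue n) cs)
lowerSteps-sum n a (suc b) cs rewrite ℕ.+-suc a b = refl

-- The reflection principle at the wall x = y, that is a = b - 1. For a = b two neighbours lie on
-- the wall and the third is the mirror image of the point itself, so its value -w cancels the loop
-- through the second row, which is forbidden there. For a = b + 1 just one neighbour lies on the
-- wall; otherwise none does.
gapSteps-sum : ∀ n {a b} (g : Gap a b) →
  rowWalks n a b
  + rayCount n (+ suc a) (+ suc b) -[1+ suc (a ℕ.+ b) ]
  + rayCount n (+ suc (suc a)) (+ suc (suc b)) -[1+ suc (suc (suc a ℕ.+ b)) ]
  + rayCount n (+ suc a) (+ suc (suc b)) -[1+ suc (suc (a ℕ.+ b)) ]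
  ≡ sumℤ (map (rowValue n) (gapSteps g))
gapSteps-sum n (closed {b}) = begin
  w + rayCount n (+ suc b) (+ suc b) -[1+ suc (b ℕ.+ b) ]
    + rayCount n (+ suc (suc b)) (+ suc (suc b)) -[1+ suc (suc (suc b ℕ.+ b)) ]
    + rayCount n (+ suc b) (+ suc (suc b)) -[1+ suc (suc (b ℕ.+ b)) ]
    ≡⟨ cong₂ _+_ (cong₂ (λ s t → w + s + t) (rayCount-diagonal n (+ suc b) _) (rayCount-diagonal n (+ suc (suc b)) _))
         (rayCount-swap₁₂ n (+ suc (suc b)) (+ suc b) _) ⟩
  w + 0ℤ + 0ℤ - w
    ≡⟨ ring w ⟩
  0ℤ ∎
  where
  w = rowWalks n b b
  ring : ∀ w → w + 0ℤ + 0ℤ - w ≡ 0ℤ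
  ring = solve-∀
gapSteps-sum n (narrow {b}) = begin
  w + v + rayCount n (+ suc (suc (suc b))) (+ suc (suc b)) -[1+ suc (suc (suc (suc b) ℕ.+ b)) ]
    + rayCount n (+ suc (suc b)) (+ suc (suc b)) -[1+ suc (suc (suc b ℕ.+ b)) ]
    ≡⟨ cong₂ (λ s t → w + v + s + t) (rowWalks-upper n (suc b) b) (rayCount-diagonal n (+ suc (suc b)) _) ⟩
  w + v + u + 0ℤ
    ≡⟨ ring u v w ⟩
  u + (v + (w + 0ℤ)) ∎
  where
  u = rowWalks n (suc b) (suc b)
  v = rowWalks n b b
  w = rowWalks n (suc b) b
  ring : ∀ u v w → w + v + u + 0ℤ ≡ u + (v + (w + 0ℤ))
  ring = solve-∀
gapSteps-sum n (wide {a} {b} _) = begin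
  w + v + rayCount n (+ suc (suc (suc (suc a)))) (+ suc (suc b)) -[1+ suc (suc (suc (suc (suc a)) ℕ.+ b)) ]
    + rayCount n (+ suc (suc (suc a))) (+ suc (suc b)) -[1+ suc (suc (suc (suc a) ℕ.+ b)) ]
    ≡⟨ cong₂ (λ s t → w + v + s + t) (rowWalks-upper n (suc (suc a)) b) (rowWalks-upper n (suc a) b) ⟩
  w + v + u + t
    ≡⟨ ring t u v w ⟩
  u + (v + (w + (t + 0ℤ))) ∎
  where
  t = rowWalks n (suc a) (suc b)
  u = rowWalks n (suc (suc a)) (suc b)
  v = rowWalks n (suc a) b
  w = rowWalks n (suc (suc a)) b
  ring : ∀ t u v w → w + v + u + t ≡ u + (v + (w + (t + 0ℤ)))
  ring = solve-∀

rowWalks-suc : ∀ n {a b} (g : Gap a b) → sumℤ (map (rowValue n) (steps g)) ≡ rowWalks (suc n) a b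
rowWalks-suc n {a} {b} g = sym (begin
  rowWalks (suc n) a b
    ≡⟨ rayCount-suc n (+ suc (suc a)) (+ suc b) -[1+ suc (suc (a ℕ.+ b)) ] ⟩
  step (rayCount n) (+ suc (suc a)) (+ suc b) -[1+ suc (suc (a ℕ.+ b)) ]
    ≡⟨ total-def w e₁ e₂ e₃ e₄ e₅ e₆ ⟩
  w + w + (e₁ + e₂ + e₃ + e₄ + e₅ + e₆)
    -- The two loops are separated: the one through the first row is always allowed, the one through
    -- the second row is counted among the steps governed by the gap.
    ≡⟨ ring w e₁ e₂ e₃ e₄ e₅ e₆ ⟩
  e₁ + (w + (e₄ + (e₅ + (w + e₂ + e₃ + e₆))))
    ≡⟨ cong (λ t → e₁ + (w + (e₄ + (e₅ + t)))) (gapSteps-sum n g) ⟩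
  e₁ + (w + (e₄ + (e₅ + sumℤ (map (rowValue n) (gapSteps g)))))
    ≡⟨ cong (λ t → e₁ + (w + t)) (lowerSteps-sum n a b (gapSteps g)) ⟩
  sumℤ (map (rowValue n) (steps g)) ∎)
  where
  w e₁ e₂ e₃ e₄ e₅ e₆ : ℤ
  w = rowWalks n a b
  e₁ = rowWalks n (suc a) b
  e₂ = rayCount n (+ suc a) (+ suc b) -[1+ suc (a ℕ.+ b) ]
  e₃ = rayCount n (+ suc (suc a)) (+ suc (suc b)) -[1+ suc (suc (suc a ℕ.+ b)) ]
  e₄ = rayCount n (+ suc (suc a)) (+ b) -[1+ suc (a ℕ.+ b) ]
  e₅ = rayCount n (+ suc (suc (suc a))) (+ b) -[1+ suc (suc (a ℕ.+ b)) ]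
  e₆ = rayCount n (+ suc a) (+ suc (suc b)) -[1+ suc (suc (a ℕ.+ b)) ]
  ring : ∀ w a b c d e f → w + w + (a + b + c + d + e + f) ≡ a + (w + (d + (e + (w + b + c + f))))
  ring = solve-∀

-- Tableaux and signed walks have the same recursion and initial values. Carrying the natural number
-- `N` along shows that the signed sum is a cardinality.
count-rowTails : ∀ n a b → b ℕ.≤ a → ∃[ N ] (HasCount (RowTail n (a , b)) N × + N ≡ rowWalks n a b)
-- At n = 0 the twelve terms compute: for b = 0 only the identity of G₂ maps the point to the ray,
-- and in the next clause, with a nonempty second row, no element does.
count-rowTails zero a zero _ = 1 , hasCount-⇔ only-empty (hasCount-singleton []) , refl
  where
  only-empty : ∀ xs → (xs ≡ []) ⇔ RowTail 0 (a , 0) xs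
  only-empty xs = mk⇔ (λ { refl → refl , tt , [] , a , [] , refl }) empty
    where
    empty : ∀ {xs} → RowTail 0 (a , 0) xs → xs ≡ []
    empty {[]} _ = refl
count-rowTails zero a (suc b) _ = 0 , hasCount-∅ none , refl
  where
  none : ∀ xs → RowTail 0 (a , suc b) xs → ⊥
  none [] (_ , _ , _ , _ , []    , ())
  none [] (_ , _ , _ , _ , _ ∷ [] , ())
count-rowTails (suc n) a b b≤a =
  let g = gap b≤a
      N , counted , N≡ = count-continuations n (steps g) (steps-unique g)
        (All.map (λ { {_ , r₁ , r₂} (_ , _ , diagram) → count-rowTails n r₁ r₂ diagram }) (steps-sound g))
  in N , hasCount-⇔ (RowTail-suc n g) counted , trans N≡ (rowWalks-suc n g)

theorem2 : (n : ℕ) → HasCount (IsTwoRowHTOneRowEnd n) (Baxter (suc n))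
theorem2 n with count-rowTails n 0 0 ℕ.z≤n
... | N , counted , N≡ = subst (HasCount (IsTwoRowHTOneRowEnd n)) (+-injective (trans N≡ (rowWalks-Baxter n)))
  (hasCount-⇔ prepend (hasCount-map ((0 , 0) ∷_) ∷-injectiveʳ counted))
  where
  prepend : ∀ ys → (∃[ xs ] (ys ≡ (0 , 0) ∷ xs × RowTail n (0 , 0) xs)) ⇔ IsTwoRowHTOneRowEnd n ys
  prepend ys = mk⇔
    (λ { (xs , refl , len , hes , diagrams , ends) → cong suc len , refl , hes , ℕ.z≤n ∷ diagrams , ends })
    restrict
    where
    restrict : ∀ {ys} → IsTwoRowHTOneRowEnd n ys → ∃[ xs ] (ys ≡ (0 , 0) ∷ xs × RowTail n (0 , 0) xs)
    restrict {_ ∷ xs} (len , refl , hes , _ ∷ diagrams , ends) = xs , refl , ℕ.suc-injective len , hes , diagrams , ends
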